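{- Let $K$ be a quadratic field with embeddings into $\mathbb{R}$ and $\mathbb{Q}_2$. Let $\alpha\in K\setminus\mathbb{Q}$ have property $I$, and assume that there exists an odd integer $n_1>1$ such that $\alpha_{(1)}=\alpha_{(n_1)}$, where $\{\alpha_{(n)}\}$ is generated by the algorithm described in the context. Let $\bar\alpha$ be the conjugate of $\alpha$. Then $$(\alpha_{\langle 2\rangle},\bar\alpha_{\langle 2\rangle})\in D_2^1\quad\text{and}\quad(\alpha_\infty,\bar\alpha_\infty)\in D_\infty^1,$$ where $D_2^1=\{(x,y)\in\mathbb{Q}_2^2\mid v_2(x)>0,\ v_2(y)\le0\}$ and $D_\infty^1=\{(x,y)\in\mathbb{R}^2\mid |x|\le1,\ |x-y|>1\}$.
   Context: $K$ is a quadratic field with fixed field embeddings $\sigma_\infty:K\to\mathbb{R}$ and $\sigma_2:K\to\mathbb{Q}_2$. For $\alpha\in K$ write $\alpha_\infty=\sigma_\infty(\alpha)$, $\alpha_{\langle 2\rangle}=\sigma_2(\alpha)$, and $\bar\alpha\in K$ for the Galois conjugate of $\alpha$ over $\mathbb{Q}$. For $u=\sum_{n}c_n2^n\in\mathbb{Q}_2$ with digits $c_n\in\{0,1\}$ ($c_n=0$ for $n<v_2(u)$), put $\lfloor u\rfloor_2=\sum_{n\le 0}c_n2^n\in\mathbb{Z}[1/2]$. Property $I$: $\alpha_\infty\in(-1,1]$ and $v_2(\alpha_{\langle 2\rangle})>0$. For $\alpha\in K^\times$ let $a^{(0)}(\alpha)=2m+\lfloor(1/\alpha)_{\langle 2\rangle}\rfloor_2$,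 where $m$ is the smallest among the integers $i$ minimizing $|(1/\alpha)_\infty-2i-\lfloor(1/\alpha)_{\langle 2\rangle}\rfloor_2|$; let $a^{(1)}(\alpha)=m'+\lfloor(1/\alpha)_{\langle 2\rangle}\rfloor_2$, where $m'$ is the smallest among the integers $i$ minimizing $|(1/\alpha)_\infty-i-\lfloor(1/\alpha)_{\langle 2\rangle}\rfloor_2|$. Put $T_{2,\epsilon}(\alpha)=\frac1\alpha-a^{(\epsilon)}(\alpha)$ for $\epsilon\in\{0,1\}$. Algorithm: $\alpha_{(1)}=\alpha$; for $n\ge1$, $\alpha_{(n+1)}=T_{2,0}(\alpha_{(n)})$ if $n$ is even and $\alpha_{(n+1)}=T_{2,1}(\alpha_{(n)})$ if $n$ is odd (for $\alpha\in K\setminus\mathbb{Q}$ the algorithm never terminates). -}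

module Defs where

open import Algebra.Bundles using (CommutativeRing)
open import Algebra.Bundles.Raw using (RawRing)
open import Algebra.Core using (Op₁; Op₂)
open import Algebra.Morphism.Structures
  using (IsRingHomomorphism; IsRingIsomorphism)
open import Data.Fin.Base using (Fin)
open import Data.Fin.Patterns using (0F; 1F)
open import Data.Integer.Base as ℤ using (ℤ; +_; 0ℤ; _%ℕ_; _/ℕ_)
open import Data.Integer.Divisibility.Signed
  using (_∣_; divides; ∣m∣n⇒∣m+n; ∣m⇒∣-m; ∣n⇒∣m*n; ∣m⇒∣m*n)
open import Data.Integer.Solver using (module +-*-Solver)
open import Data.Nat.Base as ℕ using (ℕ; zero; suc)
import Data.Nat.Divisibility as ℕ
import Data.Nat.Properties as ℕ
open import Data.Product.Base using (_×_; _,_; ∃; ∃₂)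
open import Data.Rational.Base as ℚ using (ℚ; 0ℚ; 1ℚ; ½)
import Data.Rational.Properties as ℚ
import Data.Rational.Solver as ℚ
open import Data.Sum.Base using (inj₁; inj₂)

open import Level using (Level; 0ℓ; _⊔_) renaming (suc to lsuc)
import Relation.Binary.Construct.Add.Supremum.NonStrict as SupremumNonStrict
import Relation.Binary.Construct.Add.Supremum.Strict as SupremumStrict
open import Relation.Binary.PropositionalEquality.Core
  using (_≡_; refl; sym; trans; cong; subst; subst₂)
open import Relation.Nullary.Construct.Add.Supremum using (_⁺; ⊤⁺; [_])
open import Relation.Nullary.Negation.Core using (¬_)
open import Relation.Unary using (Pred)

private
  variable
    c ℓ : Level

------------------------------------------------------------------------
-- ℝ as the completion of ℚ for the usual absolute value

Eventually : Pred ℕ 0ℓ → Set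
Eventually P = ∃ λ N → ∀ n → N ℕ.≤ n → P n

record ℝ : Set where
  constructor mkℝ
  field
    seq    : ℕ → ℚ
    cauchy : ∀ ε → 0ℚ ℚ.< ε →
             ∃ λ N → ∀ m n → N ℕ.≤ m → N ℕ.≤ n → ℚ.∣ seq m ℚ.- seq n ∣ ℚ.< ε

open ℝ public

infix  8 -ℝ_
infixl 7 _*ℝ_
infixl 6 _+ℝ_ _-ℝ_
infix  4 _≈ℝ_ _<ℝ_ _≤ℝ_

_≈ℝ_ : ℝ → ℝ → Set
x ≈ℝ y = ∀ ε → 0ℚ ℚ.< ε → Eventually λ n → ℚ.∣ seq x n ℚ.- seq y n ∣ ℚ.< ε

-- A positive rational gap is required: terms of a sequence may be
-- strictly ordered while their limits agree.
_<ℝ_ : ℝ → ℝ → Set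
x <ℝ y = ∃ λ ε → 0ℚ ℚ.< ε × Eventually λ n → seq x n ℚ.+ ε ℚ.≤ seq y n

_≤ℝ_ : ℝ → ℝ → Set
x ≤ℝ y = ¬ (y <ℝ x)

fromℚ : ℚ → ℝ
fromℚ q = mkℝ (λ _ → q) λ ε ε>0 → 0 , λ _ _ _ _ →
  subst (ℚ._< ε) (sym (cong ℚ.∣_∣ (ℚ.+-inverseʳ q))) ε>0

module ℚ-Lemmas where
  open ℚ.+-*-Solver using (_:=_; _:+_; _:-_; _:*_; :-_)
    renaming (solve to solveℚ)

  half>0 : ∀ ε → 0ℚ ℚ.< ε → 0ℚ ℚ.< ½ ℚ.* ε
  half>0 ε ε>0 = subst (ℚ._< ½ ℚ.* ε) (ℚ.*-zeroʳ ½) (ℚ.*-monoʳ-<-pos ½ ε>0)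

  half+half : ∀ ε → ½ ℚ.* ε ℚ.+ ½ ℚ.* ε ≡ ε
  half+half ε = trans (sym (ℚ.*-distribʳ-+ ε ½ ½)) (ℚ.*-identityˡ ε)

  _by_ : ∀ ε B → 0ℚ ℚ.< B → ℚ
  (ε by B) B>0 = (ℚ.1/ B) {{ℚ.>-nonZero B>0}} ℚ.* (½ ℚ.* ε)

  *-by : ∀ ε B (B>0 : 0ℚ ℚ.< B) → B ℚ.* (ε by B) B>0 ≡ ½ ℚ.* ε
  *-by ε B B>0 = trans (sym (ℚ.*-assoc B _ (½ ℚ.* ε)))
    (trans (cong (ℚ._* (½ ℚ.* ε)) (ℚ.*-inverseʳ B {{ℚ.>-nonZero B>0}}))
           (ℚ.*-identityˡ _))

  by>0 : ∀ ε B (B>0 : 0ℚ ℚ.< B) → 0ℚ ℚ.< ε → 0ℚ ℚ.< (ε by B) B>0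
  by>0 ε B B>0 ε>0 = subst (ℚ._< (ε by B) B>0) (ℚ.*-zeroʳ 1/B)
    (ℚ.*-monoʳ-<-pos 1/B {{ℚ.1/pos⇒pos B {{ℚ.positive B>0}}}} (half>0 ε ε>0))
    where 1/B = (ℚ.1/ B) {{ℚ.>-nonZero B>0}}

  a-b+b : ∀ a b → (a ℚ.- b) ℚ.+ b ≡ a
  a-b+b = solveℚ 2 (λ a b → (a :- b) :+ b := a) refl

  ∣-∣-sub : ∀ a b → ℚ.∣ a ∣ ℚ.- ℚ.∣ b ∣ ℚ.≤ ℚ.∣ a ℚ.- b ∣
  ∣-∣-sub a b = subst (ℚ.∣ a ∣ ℚ.- ℚ.∣ b ∣ ℚ.≤_)
    (solveℚ 2 (λ u v → (u :+ v) :- v := u) refl ℚ.∣ a ℚ.- b ∣ ℚ.∣ b ∣)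
    (ℚ.+-monoˡ-≤ (ℚ.- ℚ.∣ b ∣)
      (subst (λ z → ℚ.∣ z ∣ ℚ.≤ ℚ.∣ a ℚ.- b ∣ ℚ.+ ℚ.∣ b ∣) (a-b+b a b)
        (ℚ.∣p+q∣≤∣p∣+∣q∣ (a ℚ.- b) b)))

  ∣∣-sym : ∀ a b → ℚ.∣ a ℚ.- b ∣ ≡ ℚ.∣ b ℚ.- a ∣
  ∣∣-sym a b = trans (sym (ℚ.∣-p∣≡∣p∣ (a ℚ.- b)))
    (cong ℚ.∣_∣ (solveℚ 2 (λ a b → :- (a :- b) := b :- a) refl a b))

  ∣∣-nonexpansive : ∀ a b → ℚ.∣ ℚ.∣ a ∣ ℚ.- ℚ.∣ b ∣ ∣ ℚ.≤ ℚ.∣ a ℚ.- b ∣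
  ∣∣-nonexpansive a b with ℚ.∣p∣≡p∨∣p∣≡-p (ℚ.∣ a ∣ ℚ.- ℚ.∣ b ∣)
  ... | inj₁ eq = subst (ℚ._≤ ℚ.∣ a ℚ.- b ∣) (sym eq) (∣-∣-sub a b)
  ... | inj₂ eq = subst₂ ℚ._≤_
    (sym (trans eq (solveℚ 2 (λ u v → :- (u :- v) := v :- u) refl ℚ.∣ a ∣ ℚ.∣ b ∣)))
    (∣∣-sym b a) (∣-∣-sub b a)

  bound : (x : ℝ) → ∃ λ B → 0ℚ ℚ.< B × Eventually λ n → ℚ.∣ seq x n ∣ ℚ.≤ B
  bound x with cauchy x 1ℚ (ℚ.positive⁻¹ 1ℚ)
  ... | N , close = 1ℚ ℚ.+ ℚ.∣ seq x N ∣
    , ℚ.+-mono-<-≤ (ℚ.positive⁻¹ 1ℚ) (ℚ.0≤∣p∣ (seq x N))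
    , N , λ n N≤n → ℚ.≤-trans
      (subst (λ z → ℚ.∣ z ∣ ℚ.≤ ℚ.∣ seq x n ℚ.- seq x N ∣ ℚ.+ ℚ.∣ seq x N ∣)
        (a-b+b (seq x n) (seq x N)) (ℚ.∣p+q∣≤∣p∣+∣q∣ (seq x n ℚ.- seq x N) (seq x N)))
      (ℚ.+-monoˡ-≤ ℚ.∣ seq x N ∣ (ℚ.<⇒≤ (close n N N≤n ℕ.≤-refl)))

  ∣*∣< : ∀ p q {B D} → 0ℚ ℚ.< B → ℚ.∣ p ∣ ℚ.≤ B → ℚ.∣ q ∣ ℚ.< D →
        ℚ.∣ p ℚ.* q ∣ ℚ.< B ℚ.* D
  ∣*∣< p q {B} B>0 p≤B q<D = subst (ℚ._< _) (sym (ℚ.∣p*q∣≡∣p∣*∣q∣ p q))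
    (ℚ.≤-<-trans
      (ℚ.*-monoʳ-≤-nonNeg ℚ.∣ q ∣ {{ℚ.nonNegative (ℚ.0≤∣p∣ q)}} p≤B)
      (ℚ.*-monoʳ-<-pos B {{ℚ.positive B>0}} q<D))

  +-sub : ∀ a a′ b b′ → (a ℚ.- a′) ℚ.+ (b ℚ.- b′) ≡ (a ℚ.+ b) ℚ.- (a′ ℚ.+ b′)
  +-sub = solveℚ 4
    (λ a a′ b b′ → (a :- a′) :+ (b :- b′) := (a :+ b) :- (a′ :+ b′)) refl

  *-sub : ∀ a a′ b b′ →
          a ℚ.* (b ℚ.- b′) ℚ.+ b′ ℚ.* (a ℚ.- a′) ≡ a ℚ.* b ℚ.- a′ ℚ.* b′
  *-sub = solveℚ 4
    (λ a a′ b b′ → a :* (b :- b′) :+ b′ :* (a :- a′) := a :* b :- a′ :* b′) refl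

open ℚ-Lemmas

_+ℝ_ : Op₂ ℝ
x +ℝ y = mkℝ (λ n → seq x n ℚ.+ seq y n) λ ε ε>0 →
  let M , xc = cauchy x (½ ℚ.* ε) (half>0 ε ε>0)
      N , yc = cauchy y (½ ℚ.* ε) (half>0 ε ε>0)
  in M ℕ.⊔ N , λ m n p q →
    subst₂ (λ z → ℚ.∣ z ∣ ℚ.<_)
      (+-sub (seq x m) (seq x n) (seq y m) (seq y n))
      (half+half ε)
      (ℚ.≤-<-trans (ℚ.∣p+q∣≤∣p∣+∣q∣ (seq x m ℚ.- seq x n) (seq y m ℚ.- seq y n))
        (ℚ.+-mono-<
          (xc m n (ℕ.m⊔n≤o⇒m≤o M N p) (ℕ.m⊔n≤o⇒m≤o M N q))
          (yc m n (ℕ.m⊔n≤o⇒n≤o M N p) (ℕ.m⊔n≤o⇒n≤o M N q))))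

_*ℝ_ : Op₂ ℝ
x *ℝ y = mkℝ (λ n → seq x n ℚ.* seq y n) λ ε ε>0 →
  let B , B>0 , N₁ , x≤B = bound x
      C , C>0 , N₂ , y≤C = bound y
      N₃ , xc = cauchy x ((ε by C) C>0) (by>0 ε C C>0 ε>0)
      N₄ , yc = cauchy y ((ε by B) B>0) (by>0 ε B B>0 ε>0)
      N = N₁ ℕ.⊔ N₂
      M = N₃ ℕ.⊔ N₄
      n₁ = λ {k} (p : N ℕ.⊔ M ℕ.≤ k) → ℕ.m⊔n≤o⇒m≤o N₁ N₂ (ℕ.m⊔n≤o⇒m≤o N M p)
      n₂ = λ {k} (p : N ℕ.⊔ M ℕ.≤ k) → ℕ.m⊔n≤o⇒n≤o N₁ N₂ (ℕ.m⊔n≤o⇒m≤o N M p)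
      n₃ = λ {k} (p : N ℕ.⊔ M ℕ.≤ k) → ℕ.m⊔n≤o⇒m≤o N₃ N₄ (ℕ.m⊔n≤o⇒n≤o N M p)
      n₄ = λ {k} (p : N ℕ.⊔ M ℕ.≤ k) → ℕ.m⊔n≤o⇒n≤o N₃ N₄ (ℕ.m⊔n≤o⇒n≤o N M p)
  in N ℕ.⊔ M , λ m n p q →
    subst₂ (λ z → ℚ.∣ z ∣ ℚ.<_)
      (*-sub (seq x m) (seq x n) (seq y m) (seq y n))
      (half+half ε)
      (ℚ.≤-<-trans
        (ℚ.∣p+q∣≤∣p∣+∣q∣ (seq x m ℚ.* (seq y m ℚ.- seq y n)) (seq y n ℚ.* (seq x m ℚ.- seq x n)))
        (ℚ.+-mono-<
          (subst (ℚ.∣ seq x m ℚ.* (seq y m ℚ.- seq y n) ∣ ℚ.<_) (*-by ε B B>0)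
            (∣*∣< (seq x m) _ B>0 (x≤B m (n₁ p)) (yc m n (n₄ p) (n₄ q))))
          (subst (ℚ.∣ seq y n ℚ.* (seq x m ℚ.- seq x n) ∣ ℚ.<_) (*-by ε C C>0)
            (∣*∣< (seq y n) _ C>0 (y≤C n (n₂ q)) (xc m n (n₃ p) (n₃ q))))))

-ℝ_ : Op₁ ℝ
-ℝ x = mkℝ (λ n → ℚ.- seq x n) λ ε ε>0 →
  let N , xc = cauchy x ε ε>0
  in N , λ m n p q → subst (ℚ._< ε)
    (trans (sym (ℚ.∣-p∣≡∣p∣ (seq x m ℚ.- seq x n)))
      (cong ℚ.∣_∣ (ℚ.neg-distrib-+ (seq x m) (ℚ.- seq x n))))
    (xc m n p q)

_-ℝ_ : Op₂ ℝ
x -ℝ y = x +ℝ (-ℝ y)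

∣_∣ℝ : Op₁ ℝ
∣ x ∣ℝ = mkℝ (λ n → ℚ.∣ seq x n ∣) λ ε ε>0 →
  let N , xc = cauchy x ε ε>0
  in N , λ m n p q →
    ℚ.≤-<-trans (∣∣-nonexpansive (seq x m) (seq x n)) (xc m n p q)

ℝ-rawRing : RawRing 0ℓ 0ℓ
ℝ-rawRing = record
  { Carrier = ℝ
  ; _≈_     = _≈ℝ_
  ; _+_     = _+ℝ_
  ; _*_     = _*ℝ_
  ; -_      = -ℝ_
  ; 0#      = fromℚ 0ℚ
  ; 1#      = fromℚ 1ℚ
  }

------------------------------------------------------------------------
-- ℤ₂ as the inverse limit of the rings ℤ/2ⁿ

2^ : ℕ → ℤ
2^ n = + (2 ℕ.^ n)

-- residue n represents the image in ℤ/2ⁿ; it need not be reduced.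
record ℤ₂ : Set where
  constructor mkℤ₂
  field
    residue  : ℕ → ℤ
    coherent : ∀ n → 2^ n ∣ residue (suc n) ℤ.- residue n

open ℤ₂ public

infixl 7 _*ℤ₂_
infixl 6 _+ℤ₂_
infix  4 _≈ℤ₂_

_≈ℤ₂_ : ℤ₂ → ℤ₂ → Set
s ≈ℤ₂ t = ∀ n → 2^ n ∣ residue s n ℤ.- residue t n

fromℤ : ℤ → ℤ₂
fromℤ i = mkℤ₂ (λ _ → i) λ n → divides 0ℤ (solve 1 (λ i → i :- i := con 0ℤ) refl i)
  where open +-*-Solver

_+ℤ₂_ : Op₂ ℤ₂
s +ℤ₂ t = mkℤ₂ (λ n → residue s n ℤ.+ residue t n) λ n →
  subst (2^ n ∣_)
    (solve 4 (λ a′ a b′ b → (a′ :- a) :+ (b′ :- b) := (a′ :+ b′) :- (a :+ b)) refl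
      (residue s (suc n)) (residue s n) (residue t (suc n)) (residue t n))
    (∣m∣n⇒∣m+n (coherent s n) (coherent t n))
  where open +-*-Solver

_*ℤ₂_ : Op₂ ℤ₂
s *ℤ₂ t = mkℤ₂ (λ n → residue s n ℤ.* residue t n) λ n →
  subst (2^ n ∣_)
    (solve 4 (λ a′ a b′ b → (a′ :- a) :* b′ :+ a :* (b′ :- b) := a′ :* b′ :- a :* b) refl
      (residue s (suc n)) (residue s n) (residue t (suc n)) (residue t n))
    (∣m∣n⇒∣m+n (∣m⇒∣m*n (residue t (suc n)) (coherent s n))
               (∣n⇒∣m*n (residue s n) (coherent t n)))
  where open +-*-Solver

-ℤ₂_ : Op₁ ℤ₂
-ℤ₂ t = mkℤ₂ (λ n → ℤ.- residue t n) λ n →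
  subst (2^ n ∣_)
    (solve 2 (λ a′ a → :- (a′ :- a) := :- a′ :- (:- a)) refl
      (residue t (suc n)) (residue t n))
    (∣m⇒∣-m (coherent t n))
  where open +-*-Solver

-- The digit cᵢ ∈ {0,1} in t = Σ_{i≥0} cᵢ 2ⁱ: bit i of any integer
-- congruent to t modulo 2ⁱ⁺¹ (two's complement for negative integers,
-- as /ℕ rounds towards -∞).
digit : ℤ₂ → ℕ → ℕ
digit t i = (residue t (suc i) /ℕ (2 ℕ.^ i)) %ℕ 2
  where instance _ = ℕ.m^n≢0 2 i

-- Σ_{i<n} cᵢ 2ⁱ
digitSum : ℤ₂ → ℕ → ℕ
digitSum t zero    = 0
digitSum t (suc n) = digitSum t n ℕ.+ digit t n ℕ.* 2 ℕ.^ n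

------------------------------------------------------------------------
-- ℚ₂ as the localisation ℤ₂[1/2]

infix 5 _/2^_

-- t /2^ e stands for t / 2ᵉ; t need not be odd.
record ℚ₂ : Set where
  constructor _/2^_
  field
    numerator : ℤ₂
    exponent  : ℕ

infix  4 _≈ℚ₂_

_≈ℚ₂_ : ℚ₂ → ℚ₂ → Set
(s /2^ e) ≈ℚ₂ (t /2^ f) = fromℤ (2^ f) *ℤ₂ s ≈ℤ₂ fromℤ (2^ e) *ℤ₂ t

ℚ₂-rawRing : RawRing 0ℓ 0ℓ
ℚ₂-rawRing = record
  { Carrier = ℚ₂
  ; _≈_     = _≈ℚ₂_
  ; _+_     = λ (s /2^ e) (t /2^ f) →
                (fromℤ (2^ f) *ℤ₂ s +ℤ₂ fromℤ (2^ e) *ℤ₂ t) /2^ (e ℕ.+ f)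
  ; _*_     = λ (s /2^ e) (t /2^ f) → (s *ℤ₂ t) /2^ (e ℕ.+ f)
  ; -_      = λ (t /2^ e) → (-ℤ₂ t) /2^ e
  ; 0#      = fromℤ (+ 0) /2^ 0
  ; 1#      = fromℤ (+ 1) /2^ 0
  }

-- The coefficient of 2ⁿ in t / 2ᵉ is digit t (n + e), so n ≤ 0 selects
-- the first e + 1 digits of t.
⌊_⌋₂ : ℚ₂ → ℚ
⌊ t /2^ e ⌋₂ = (+ digitSum t (suc e)) ℚ./ (2 ℕ.^ e)
  where instance _ = ℕ.m^n≢0 2 e

-- The graph of v₂ : ℚ₂ → ℤ ∪ {∞}; deciding u = 0, hence computing v₂ u,
-- is not possible for arbitrary u.
data _HasValuation_ : ℚ₂ → ℤ ⁺ → Set where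
  infinite : ∀ {u} → u ≈ℚ₂ RawRing.0# ℚ₂-rawRing → u HasValuation ⊤⁺
  finite   : ∀ {t e} j → 2^ j ∣ residue t j → ¬ (2^ (suc j) ∣ residue t (suc j)) →
             (t /2^ e) HasValuation [ + j ℤ.- + e ]

open SupremumStrict    ℤ._<_ public using () renaming (_<⁺_ to _<∞_)
open SupremumNonStrict ℤ._≤_ public using () renaming (_≤⁺_ to _≤∞_)

v₂>0 : ℚ₂ → Set
v₂>0 u = ∃ λ w → u HasValuation w × [ 0ℤ ] <∞ w

v₂≤0 : ℚ₂ → Set
v₂≤0 u = ∃ λ w → u HasValuation w × w ≤∞ [ 0ℤ ]

------------------------------------------------------------------------
-- Quadratic fields

-- A field of dimension 2 over ℚ, with (1, θ) as a ℚ-basis.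
record QuadraticField c ℓ : Set (lsuc (c ⊔ ℓ)) where
  field
    commutativeRing : CommutativeRing c ℓ

  open CommutativeRing commutativeRing public

  infix 9 _⁻¹

  field
    1≉0          : 1# ≉ 0#
    -- The value 0# ⁻¹ is unconstrained.
    _⁻¹          : Op₁ Carrier
    ⁻¹-inverseʳ  : ∀ x → x ≉ 0# → x * x ⁻¹ ≈ 1#
    ι            : ℚ → Carrier
    ι-homo       : IsRingHomomorphism ℚ.+-*-rawRing rawRing ι
    θ            : Carrier
    spanning     : ∀ x → ∃₂ λ p q → x ≈ ι p + ι q * θ
    independent  : ∀ p q → ι p + ι q * θ ≈ 0# → p ≡ 0ℚ × q ≡ 0ℚ

  Irrational : Pred Carrier ℓ
  Irrational α = ∀ q → α ≉ ι q

  -- The non-trivial automorphism over ℚ.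
  record IsGaloisConjugation (conj : Op₁ Carrier) : Set (c ⊔ ℓ) where
    field
      isRingIsomorphism : IsRingIsomorphism rawRing rawRing conj
      fixesℚ            : ∀ q → conj (ι q) ≈ ι q
      nontrivial        : ¬ (∀ x → conj x ≈ x)

------------------------------------------------------------------------
-- The continued fraction algorithm

IsMinimizer : (ℤ → ℝ) → Pred ℤ 0ℓ
IsMinimizer f m = ∀ i → f m ≤ℝ f i

IsLeastMinimizer : (ℤ → ℝ) → Pred ℤ 0ℓ
IsLeastMinimizer f m = IsMinimizer f m × (∀ i → IsMinimizer f i → m ℤ.≤ i)

spacing : Fin 2 → ℤ
spacing 0F = + 2
spacing 1F = + 1

module Algorithm (K : QuadraticField c ℓ)
                 (σ∞ : QuadraticField.Carrier K → ℝ)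
                 (σ₂ : QuadraticField.Carrier K → ℚ₂) where

  open QuadraticField K

  PropertyI : Pred Carrier 0ℓ
  PropertyI α = (fromℚ (ℚ.- 1ℚ) <ℝ σ∞ α × σ∞ α ≤ℝ fromℚ 1ℚ) × v₂>0 (σ₂ α)

  candidate : Fin 2 → Carrier → ℤ → ℚ
  candidate ε α i = (spacing ε ℤ.* i) ℚ./ 1 ℚ.+ ⌊ σ₂ (α ⁻¹) ⌋₂

  distance : Fin 2 → Carrier → ℤ → ℝ
  distance ε α i = ∣ σ∞ (α ⁻¹) -ℝ fromℚ (candidate ε α i) ∣ℝ

  -- The graph of a⁽ᵉ⁾ : Kˣ → ℤ[1/2].
  PartialQuotient : Fin 2 → Carrier → ℚ → Set ℓ
  PartialQuotient ε α a = α ≉ 0# ×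
    ∃ λ m → IsLeastMinimizer (distance ε α) m × a ≡ candidate ε α m

  -- The graph of T₂,ₑ.
  T₂ : Fin 2 → Carrier → Carrier → Set ℓ
  T₂ ε α β = ∃ λ a → PartialQuotient ε α a × β ≈ α ⁻¹ - ι a

  -- Terms are numbered from 1; the value at 0 is ignored.
  record Generates (α : Carrier) (α[_] : ℕ → Carrier) : Set ℓ where
    field
      start : α[ 1 ] ≈ α
      even  : ∀ n → 1 ℕ.≤ n → 2 ℕ.∣ n → T₂ 0F α[ n ] α[ suc n ]
      odd   : ∀ n → 1 ℕ.≤ n → ¬ (2 ℕ.∣ n) → T₂ 1F α[ n ] α[ suc n ]

------------------------------------------------------------------------

D₂¹ : Pred (ℚ₂ × ℚ₂) 0ℓ
D₂¹ (x , y) = v₂>0 x × v₂≤0 y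

D∞¹ : Pred (ℝ × ℝ) 0ℓ
D∞¹ (x , y) = ∣ x ∣ℝ ≤ℝ fromℚ 1ℚ × fromℚ 1ℚ <ℝ ∣ x -ℝ y ∣ℝ

{-# OPTIONS --safe #-}
module Submission where

-- The differences δₙ = αₙ - ᾱₙ satisfy δₙ = - δₙ₊₁ αₙ ᾱₙ, and both halves of the
-- theorem follow by running this relation once around the period.
--
-- At 2: αₙ has positive valuation for odd n and is integral for even n. If ᾱ₁ had
-- positive valuation, then so would, going backwards through the period, every ᾱₙ
-- with n odd, and every ᾱₙ with n even would be integral. Hence δ₁ = δ₁ P with
-- v₂(P) > 0, which contradicts δ₁ ≠ 0.
--
-- At ∞: |αₙ| ≤ 1 for odd n and |αₙ| ≤ 1/2 for even n, because the partial quotients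
-- minimise a distance. With |ᾱₙ| ≤ |αₙ| + |δₙ|, two steps from an odd n lead from
-- |δₙ| = d to |δₙ₊₂| > 4d / (1 + 3d), which is at least d when d ≤ 1. So |δ₁| ≤ 1 would
-- make |δₙ| exceed |δ₁| at all later odd n, against periodicity.
--
-- Every x ≠ 0 in K has an inverse, so its real image is apart from 0; the order that σ∞
-- induces on K is therefore decidable, and |δ₁| > 1 is obtained with a positive gap.

open import Defs
open import Algebra.Bundles.Raw using (RawRing)
open import Algebra.Core using (Op₁)
open import Algebra.Morphism.Structures
  using (IsRingHomomorphism; IsRingIsomorphism; IsRingMonomorphism)
import Algebra.Properties.Ring as RingProperties
import Algebra.Solver.Ring as RingSolver
open import Algebra.Solver.Ring.AlmostCommutativeRing
  using (fromCommutativeRing; _-Raw-AlmostCommutative⟶_)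
open import Data.Empty using (⊥; ⊥-elim)
open import Data.Fin.Base using (Fin)
open import Data.Fin.Patterns using (0F; 1F)
open import Data.Integer.Base as ℤ using (ℤ; +_; +[1+_]; -[1+_]; 0ℤ; _%ℕ_; _/ℕ_)
open import Data.Integer.Divisibility.Signed as ℤ∣ using () renaming (_∣_ to _∣ℤ_; _∣?_ to _∣ℤ?_)
import Data.Integer.DivMod as ℤ
import Data.Integer.Properties as ℤ
open import Data.Integer.Solver using () renaming (module +-*-Solver to ℤS)
open import Data.Maybe.Base using (Maybe; just; nothing)
open import Data.Nat.Base as ℕ using (ℕ; zero; suc; _<_; z≤n; s≤s)
open import Data.Nat.Coprimality using (Coprime)
open import Data.Nat.Divisibility using (_∣_)
import Data.Nat.Divisibility as ℕ
import Data.Nat.DivMod as ℕ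
import Data.Nat.Properties as ℕ
open import Data.Nat.Solver using () renaming (module +-*-Solver to ℕS)
open import Data.Product.Base using (_×_; _,_; proj₁; proj₂; ∃)
open import Data.Rational.Base as ℚ using (ℚ; mkℚ; 0ℚ; 1ℚ; ½)
import Data.Rational.Properties as ℚ
open import Data.Rational.Solver using () renaming (module +-*-Solver to ℚS)
import Data.Rational.Unnormalised.Base as ℚᵘ
import Data.Rational.Unnormalised.Properties as ℚᵘ
open import Data.Sum.Base as Sum using (_⊎_; inj₁; inj₂)
open import Function.Base using (id)
open import Level using (_⊔_)
import Relation.Binary.Construct.Add.Supremum.NonStrict ℤ._≤_ as NonStrict
import Relation.Binary.Construct.Add.Supremum.Strict ℤ._<_ as Strict
import Relation.Binary.PropositionalEquality.Core as ≡
open ≡ using (_≡_)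
import Relation.Binary.Reasoning.Setoid as SetoidReasoning
open import Relation.Nullary.Decidable.Core using (yes; no)
open import Relation.Nullary.Negation.Core using (¬_; contradiction)
open import Relation.Unary using (Pred; _∈_; _∩_)

open RawRing ℚ₂-rawRing using ()
  renaming (_+_ to _+ℚ₂_; _*_ to _*ℚ₂_; -_ to -ℚ₂_; 1# to 1ℚ₂; 0# to 0ℚ₂)

-- Divisibility by powers of 2 and the digits of a 2-adic integer.

module DyadicNumbers where
  open import Data.Nat.Base using (_+_; _≤_)
  open ℤ∣ using (divides; ∣m∣n⇒∣m+n; ∣m⇒∣-m; ∣n⇒∣m*n; ∣⇒∣ᵤ; ∣-refl; ∣-trans)
  open ≡ using (refl; sym; trans; cong; cong₂; subst; subst₂)

  2^-+ : ∀ m n → 2^ (m + n) ≡ 2^ m ℤ.* 2^ n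
  2^-+ m n = trans (cong +_ (ℕ.^-distribˡ-+-* 2 m n)) (ℤ.pos-* (2 ℕ.^ m) (2 ℕ.^ n))

  2^≢0 : ∀ n → ℤ.NonZero (2^ n)
  2^≢0 n = ℕ.m^n≢0 2 n

  2^0-∣ : ∀ x → 2^ 0 ∣ℤ x
  2^0-∣ x = divides x (sym (ℤ.*-identityʳ x))

  2^-mono-∣ : ∀ {m n} → m ≤ n → 2^ m ∣ℤ 2^ n
  2^-mono-∣ {m} {n} m≤n = divides (2^ (n ℕ.∸ m))
    (trans (cong 2^ (sym (ℕ.m∸n+n≡m m≤n))) (2^-+ (n ℕ.∸ m) m))

  *-pres-2^∣ : ∀ m n {N x y} → N ≡ m + n → 2^ m ∣ℤ x → 2^ n ∣ℤ y → 2^ N ∣ℤ x ℤ.* y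
  *-pres-2^∣ m n refl (divides q refl) (divides r refl) = divides (q ℤ.* r)
    (trans (solve 4 (λ q a r b → q :* a :* (r :* b) := q :* r :* (a :* b)) refl q (2^ m) r (2^ n))
           (cong (q ℤ.* r ℤ.*_) (sym (2^-+ m n))))
    where open ℤS

  2^*-mono-∣ : ∀ m n {N x} → N ≡ m + n → 2^ n ∣ℤ x → 2^ N ∣ℤ 2^ m ℤ.* x
  2^*-mono-∣ m n eq = *-pres-2^∣ m n eq ∣-refl

  2^*-cancel-∣ : ∀ m n {N x} → N ≡ m + n → 2^ N ∣ℤ 2^ m ℤ.* x → 2^ n ∣ℤ x
  2^*-cancel-∣ m n {x = x} refl d =
    ℤ∣.*-cancelˡ-∣ (2^ m) {{2^≢0 m}} (subst (_∣ℤ 2^ m ℤ.* x) (2^-+ m n) d)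

  ∣-by-sub : ∀ {k x y} → k ∣ℤ x ℤ.- y → k ∣ℤ y → k ∣ℤ x
  ∣-by-sub {k} {x} {y} p q =
    subst (k ∣ℤ_) (solve 2 (λ x y → x :- y :+ y := x) refl x y) (∣m∣n⇒∣m+n p q)
    where open ℤS

  ∣-sub-sym : ∀ {k} x y → k ∣ℤ x ℤ.- y → k ∣ℤ y ℤ.- x
  ∣-sub-sym {k} x y p =
    subst (k ∣ℤ_) (solve 2 (λ x y → :- (x :- y) := y :- x) refl x y) (∣m⇒∣-m p)
    where open ℤS

  ∣-sub-trans : ∀ {k} x y z → k ∣ℤ x ℤ.- y → k ∣ℤ y ℤ.- z → k ∣ℤ x ℤ.- z
  ∣-sub-trans {k} x y z p q =
    subst (k ∣ℤ_) (solve 3 (λ x y z → (x :- y) :+ (y :- z) := x :- z) refl x y z) (∣m∣n⇒∣m+n p q)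
    where open ℤS

  even-or-odd : ∀ x → ∃ λ z → x ≡ 2^ 1 ℤ.* z ⊎ x ≡ + 1 ℤ.+ 2^ 1 ℤ.* z
  even-or-odd x with x %ℕ 2 in eq | ℤ.n%ℕd<d x 2 | ℤ.a≡a%ℕn+[a/ℕn]*n x 2
  ... | 0 | _ | e = x /ℕ 2 , inj₁ (trans e
        (solve 1 (λ z → con (+ 0) :+ z :* con (+ 2) := con (+ 2) :* z) refl (x /ℕ 2)))
    where open ℤS
  ... | 1 | _ | e = x /ℕ 2 , inj₂ (trans e
        (solve 1 (λ z → con (+ 1) :+ z :* con (+ 2) := con (+ 1) :+ con (+ 2) :* z) refl (x /ℕ 2)))
    where open ℤS
  ... | suc (suc _) | s≤s (s≤s ()) | _

  -- Induction on `n`: once `y` is `w` times `2^ n`, the hypothesis leaves an even product of the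
  -- odd factor with `w`, and subtracting the even number `2zw` leaves `w` itself.
  odd-cancel-2^∣ : ∀ n z y → 2^ n ∣ℤ (+ 1 ℤ.+ 2^ 1 ℤ.* z) ℤ.* y → 2^ n ∣ℤ y
  odd-cancel-2^∣ zero    z y _ = 2^0-∣ y
  odd-cancel-2^∣ (suc n) z y d with odd-cancel-2^∣ n z y (∣-trans (2^-mono-∣ (ℕ.n≤1+n n)) d)
  ... | divides w refl = subst (2^ (suc n) ∣ℤ_) (ℤ.*-comm (2^ n) w)
    (2^*-mono-∣ n 1 (ℕ.+-comm 1 n)
      (subst (2^ 1 ∣ℤ_)
        (solve 3 (λ p z w → (con (+ 1) :+ p :* z) :* w :- z :* w :* p := w) refl (2^ 1) z w)
        (ℤ∣.∣m∣n⇒∣m-n odd*w (divides (z ℤ.* w) refl))))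
    where
    open ℤS
    odd*w : 2^ 1 ∣ℤ (+ 1 ℤ.+ 2^ 1 ℤ.* z) ℤ.* w
    odd*w = 2^*-cancel-∣ n 1 (ℕ.+-comm 1 n) (subst (2^ (suc n) ∣ℤ_)
      (solve 3 (λ u w p → u :* (w :* p) := p :* (u :* w)) refl (+ 1 ℤ.+ 2^ 1 ℤ.* z) w (2^ n)) d)

  -- In terms of valuations, v(x) + v(y) ≥ a + b - 1 forces v(x) ≥ a or v(y) ≥ b; the factor `2^ 1`
  -- stands for the - 1. Induction on `a`: an odd `x` cancels and leaves all the divisibility to
  -- `y`, while an even `x` gives up one factor 2.
  2^∣*-split : ∀ a b x y → 2^ (a + b) ∣ℤ 2^ 1 ℤ.* (x ℤ.* y) → 2^ a ∣ℤ x ⊎ 2^ b ∣ℤ y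
  2^∣*-split zero b x y d = inj₁ (2^0-∣ x)
  2^∣*-split (suc a) b x y d with even-or-odd x
  ... | z , inj₂ refl = inj₂ (∣-trans (2^-mono-∣ (ℕ.m≤n+m b a))
          (odd-cancel-2^∣ (a + b) z y
            (2^*-cancel-∣ 1 (a + b) {suc (a + b)} {(+ 1 ℤ.+ 2^ 1 ℤ.* z) ℤ.* y} refl d)))
  ... | z , inj₁ refl = Sum.map₁ (2^*-mono-∣ 1 a {suc a} {z} refl) (2^∣*-split a b z y
          (2^*-cancel-∣ 1 (a + b) {suc (a + b)} {2^ 1 ℤ.* (z ℤ.* y)} refl
            (subst (λ w → 2^ (suc (a + b)) ∣ℤ 2^ 1 ℤ.* w) (ℤ.*-assoc (2^ 1) z y) d)))

  residue-coherent : ∀ t {m n} → m ≤ n → 2^ m ∣ℤ residue t n ℤ.- residue t m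
  residue-coherent t {m} m≤n = go (ℕ.≤⇒≤′ m≤n)
    where
    go : ∀ {n} → m ℕ.≤′ n → 2^ m ∣ℤ residue t n ℤ.- residue t m
    go (ℕ.≤′-reflexive refl) = divides 0ℤ (ℤ.+-inverseʳ (residue t m))
    go (ℕ.≤′-step {n} m≤′n) = ∣-sub-trans (residue t (suc n)) (residue t n) (residue t m)
      (∣-trans (2^-mono-∣ (ℕ.≤′⇒≤ m≤′n)) (coherent t n)) (go m≤′n)

  2^∣residue-raise : ∀ t {m n} → m ≤ n → 2^ m ∣ℤ residue t m → 2^ m ∣ℤ residue t n
  2^∣residue-raise t m≤n = ∣-by-sub (residue-coherent t m≤n)

  2^∣residue-lower : ∀ t {m n} → m ≤ n → 2^ m ∣ℤ residue t n → 2^ m ∣ℤ residue t m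
  2^∣residue-lower t {m} {n} m≤n =
    ∣-by-sub (∣-sub-sym (residue t n) (residue t m) (residue-coherent t m≤n))

  -- A non-zero multiple of `d` has absolute value at least `d`, but the difference is bounded by
  -- the larger of `a` and `b`.
  ∣-sub⇒≡ : ∀ {d a b} → + d ∣ℤ + a ℤ.- + b → a < d → b < d → a ≡ b
  ∣-sub⇒≡ {d} {a} {b} d∣a-b a<d b<d with ℤ.∣ + a ℤ.- + b ∣ in eq | ∣⇒∣ᵤ d∣a-b
  ... | zero  | _ = ℤ.+-injective (ℤ.i-j≡0⇒i≡j (+ a) (+ b) (ℤ.∣i∣≡0⇒i≡0 eq))
  ... | suc k | p = ⊥-elim (ℕ.>⇒∤ (subst (_< d) eq
    (ℕ.≤-<-trans (subst (λ w → ℤ.∣ w ∣ ≤ a ℕ.⊔ b) (sym (ℤ.m-n≡m⊖n a b)) (ℤ.∣m⊝n∣≤m⊔n a b))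
      (ℕ.⊔-lub a<d b<d))) p)

  -- Coherence makes the sum of the first `n` digits congruent modulo `2^ n` to the residue at level
  -- `n + 1`. Both it and the remainder of that residue are reduced, so they agree; the new digit is
  -- then the parity of the quotient.
  digitSum-correct : ∀ t n → digitSum t n < 2 ℕ.^ n × 2^ n ∣ℤ residue t n ℤ.- + digitSum t n
  digitSum-correct t zero    = s≤s z≤n , 2^0-∣ _
  digitSum-correct t (suc n) = bound , divides Q′ eq
    where
    open ℤS
    instance _ = ℕ.m^n≢0 2 n
    D = digitSum t n
    c = digit t n
    r = residue t (suc n)
    ρ = r %ℕ (2 ℕ.^ n)
    Q = r /ℕ (2 ℕ.^ n)
    Q′ = Q /ℕ 2
    IH = digitSum-correct t n
    bound : D + c ℕ.* 2 ℕ.^ n < 2 ℕ.^ suc n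
    bound = ℕ.<-≤-trans (ℕ.+-monoˡ-< (c ℕ.* 2 ℕ.^ n) (proj₁ IH))
      (ℕ.*-monoˡ-≤ (2 ℕ.^ n) (ℤ.n%ℕd<d Q 2))
    2^∣r-D : 2^ n ∣ℤ r ℤ.- + D
    2^∣r-D = ∣-sub-trans r (residue t n) (+ D) (coherent t n) (proj₂ IH)
    ρ≡D : ρ ≡ D
    ρ≡D = ∣-sub⇒≡ {2 ℕ.^ n} (∣-sub-trans (+ ρ) r (+ D)
        (∣-sub-sym r (+ ρ) (divides Q (trans (cong (ℤ._- + ρ) (ℤ.a≡a%ℕn+[a/ℕn]*n r (2 ℕ.^ n)))
          (solve 3 (λ ρ Q p → ρ :+ Q :* p :- ρ := Q :* p) refl (+ ρ) Q (2^ n))))) 2^∣r-D)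
      (ℤ.n%ℕd<d r (2 ℕ.^ n)) (proj₁ IH)
    eq : r ℤ.- + (D + c ℕ.* 2 ℕ.^ n) ≡ Q′ ℤ.* 2^ (suc n)
    eq = trans (cong₂ ℤ._-_
           (trans (ℤ.a≡a%ℕn+[a/ℕn]*n r (2 ℕ.^ n))
             (cong₂ (λ u v → + u ℤ.+ v ℤ.* 2^ n) ρ≡D (ℤ.a≡a%ℕn+[a/ℕn]*n Q 2)))
           (trans (ℤ.pos-+ D (c ℕ.* 2 ℕ.^ n)) (cong (ℤ._+_ (+ D)) (ℤ.pos-* c (2 ℕ.^ n)))))
         (trans (solve 4 (λ D c Q′ p → D :+ (c :+ Q′ :* con (+ 2)) :* p :- (D :+ c :* p)
                   := Q′ :* (con (+ 2) :* p)) refl (+ D) (+ c) Q′ (2^ n))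
           (cong (Q′ ℤ.*_) (sym (2^-+ 1 n))))

  -- Equality in ℚ₂ and lower bounds for the valuation.

  ≈ℚ₂-refl : ∀ {u} → u ≈ℚ₂ u
  ≈ℚ₂-refl {t /2^ e} n = divides 0ℤ (ℤ.+-inverseʳ (2^ e ℤ.* residue t n))

  ≈ℚ₂-sym : ∀ {u v} → u ≈ℚ₂ v → v ≈ℚ₂ u
  ≈ℚ₂-sym {s /2^ e} {t /2^ f} p n = ∣-sub-sym (2^ f ℤ.* residue s n) (2^ e ℤ.* residue t n) (p n)

  -- The common factor 2ᶠ of the two hypotheses is cancelled at level f + n.
  ≈ℚ₂-trans : ∀ {u v w} → u ≈ℚ₂ v → v ≈ℚ₂ w → u ≈ℚ₂ w
  ≈ℚ₂-trans {s /2^ e} {t /2^ f} {r /2^ g} p q n =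
    ∣-sub-trans (2^ g ℤ.* s₀) (2^ g ℤ.* s₁) (2^ e ℤ.* r₀)
      (lower g s)
      (∣-sub-trans (2^ g ℤ.* s₁) (2^ e ℤ.* r₁) (2^ e ℤ.* r₀)
        (2^*-cancel-∣ f n refl (subst (2^ N ∣ℤ_)
          (solve 6 (λ pe pf pg s t r → pg :* (pf :* s :- pe :* t) :+ pe :* (pg :* t :- pf :* r)
              := pf :* (pg :* s :- pe :* r)) refl (2^ e) (2^ f) (2^ g) s₁ (residue t N) r₁)
          (∣m∣n⇒∣m+n (∣n⇒∣m*n (2^ g) (p N)) (∣n⇒∣m*n (2^ e) (q N)))))
        (∣-sub-sym (2^ e ℤ.* r₀) (2^ e ℤ.* r₁) (lower e r)))
    where
    open ℤS
    N = f + n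
    s₀ = residue s n
    s₁ = residue s N
    r₀ = residue r n
    r₁ = residue r N
    lower : ∀ k z → 2^ n ∣ℤ 2^ k ℤ.* residue z n ℤ.- 2^ k ℤ.* residue z N
    lower k z = subst (2^ n ∣ℤ_)
      (solve 3 (λ p a b → p :* (a :- b) := p :* a :- p :* b) refl (2^ k) (residue z n) (residue z N))
      (∣n⇒∣m*n (2^ k) (∣-sub-sym (residue z N) (residue z n) (residue-coherent z (ℕ.m≤n+m n f))))

  +ℚ₂-cong : ∀ {u u′ v v′} → u ≈ℚ₂ u′ → v ≈ℚ₂ v′ → u +ℚ₂ v ≈ℚ₂ u′ +ℚ₂ v′
  +ℚ₂-cong {s /2^ e} {s′ /2^ e′} {t /2^ f} {t′ /2^ f′} p q n =
    subst (2^ n ∣ℤ_)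
      (trans (solve 8 (λ e e′ f f′ s s′ t t′ →
          f :* f′ :* (e′ :* s :- e :* s′) :+ e :* e′ :* (f′ :* t :- f :* t′)
          := e′ :* f′ :* (f :* s :+ e :* t) :- e :* f :* (f′ :* s′ :+ e′ :* t′)) refl
          (2^ e) (2^ e′) (2^ f) (2^ f′) (residue s n) (residue s′ n) (residue t n) (residue t′ n))
        (cong₂ (λ a b → a ℤ.* (2^ f ℤ.* residue s n ℤ.+ 2^ e ℤ.* residue t n)
                   ℤ.- b ℤ.* (2^ f′ ℤ.* residue s′ n ℤ.+ 2^ e′ ℤ.* residue t′ n))
          (sym (2^-+ e′ f′)) (sym (2^-+ e f))))
      (∣m∣n⇒∣m+n (∣n⇒∣m*n (2^ f ℤ.* 2^ f′) (p n)) (∣n⇒∣m*n (2^ e ℤ.* 2^ e′) (q n)))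
    where open ℤS

  -- v₂ u ≥ k, for k ≥ 0.
  Val≥ : ℕ → ℚ₂ → Set
  Val≥ k (t /2^ e) = 2^ (k + e) ∣ℤ residue t (k + e)

  -- The representatives may have different exponents. They are compared at level `k + e + f`, high
  -- enough to cancel `2^ e` and still descend to level `k + f`.
  Val≥-resp-≈ : ∀ {k u v} → u ≈ℚ₂ v → Val≥ k u → Val≥ k v
  Val≥-resp-≈ {k} {s /2^ e} {t /2^ f} u≈v d =
    2^∣residue-lower t k+f≤N (2^*-cancel-∣ e (k + f) N≡e+[k+f]
      (∣-by-sub (∣-sub-sym (2^ f ℤ.* residue s N) (2^ e ℤ.* residue t N) (u≈v N))
        (2^*-mono-∣ f (k + e) (ℕ.+-comm (k + e) f) (2^∣residue-raise s (ℕ.m≤m+n (k + e) f) d))))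
    where
    open ℕS
    N = k + e + f
    N≡e+[k+f] : N ≡ e + (k + f)
    N≡e+[k+f] = solve 3 (λ k e f → k :+ e :+ f := e :+ (k :+ f)) refl k e f
    k+f≤N : k + f ≤ N
    k+f≤N = subst (k + f ≤_) (sym N≡e+[k+f]) (ℕ.m≤n+m (k + f) e)

  Val≥-+ : ∀ {k u v} → Val≥ k u → Val≥ k v → Val≥ k (u +ℚ₂ v)
  Val≥-+ {k} {s /2^ e} {t /2^ f} p q = ∣m∣n⇒∣m+n
    (2^*-mono-∣ f (k + e) eq₁ (2^∣residue-raise s (subst (k + e ≤_) (sym eq₁) (ℕ.m≤n+m (k + e) f)) p))
    (2^*-mono-∣ e (k + f) eq₂ (2^∣residue-raise t (subst (k + f ≤_) (sym eq₂) (ℕ.m≤n+m (k + f) e)) q))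
    where
    open ℕS
    eq₁ : k + (e + f) ≡ f + (k + e)
    eq₁ = solve 3 (λ k e f → k :+ (e :+ f) := f :+ (k :+ e)) refl k e f
    eq₂ : k + (e + f) ≡ e + (k + f)
    eq₂ = solve 3 (λ k e f → k :+ (e :+ f) := e :+ (k :+ f)) refl k e f

  Val≥-double : ∀ {k u} → Val≥ k u → Val≥ (suc k) (u +ℚ₂ u)
  Val≥-double {k} {s /2^ e} p =
    subst (2^ N ∣ℤ_) (ℤS.solve 1 (λ x → ℤS.con (+ 2) ℤS.:* x ℤS.:= x ℤS.:+ x) refl (2^ e ℤ.* residue s N))
      (2^*-mono-∣ 1 (k + (e + e)) refl (2^*-mono-∣ e (k + e) eq
        (2^∣residue-raise s (ℕ.≤-trans (subst (k + e ≤_) (sym eq) (ℕ.m≤n+m (k + e) e)) (ℕ.n≤1+n _)) p)))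
    where
    open ℕS
    N = suc k + (e + e)
    eq : k + (e + e) ≡ e + (k + e)
    eq = solve 2 (λ k e → k :+ (e :+ e) := e :+ (k :+ e)) refl k e

  Val≥-neg : ∀ {k u} → Val≥ k u → Val≥ k (-ℚ₂ u)
  Val≥-neg {k} {s /2^ e} p = ∣m⇒∣-m p

  Val≥-* : ∀ {k l u v} → Val≥ k u → Val≥ l v → Val≥ (k + l) (u *ℚ₂ v)
  Val≥-* {k} {l} {s /2^ e} {t /2^ f} p q = *-pres-2^∣ (k + e) (l + f) eq
    (2^∣residue-raise s (subst (k + e ≤_) (sym eq) (ℕ.m≤m+n (k + e) (l + f))) p)
    (2^∣residue-raise t (subst (l + f ≤_) (sym eq) (ℕ.m≤n+m (l + f) (k + e))) q)
    where
    open ℕS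
    eq : k + l + (e + f) ≡ k + e + (l + f)
    eq = solve 4 (λ k l e f → k :+ l :+ (e :+ f) := k :+ e :+ (l :+ f)) refl k l e f

  -- Integrality of the product means that `2^ (e + f)` divides the product of the numerators.
  -- Doubling it brings it into the form of `2^∣*-split` with exponents `e` and `f + 1`.
  Val≥-*-split : ∀ {u v} → Val≥ 0 (u *ℚ₂ v) → Val≥ 0 u ⊎ Val≥ 1 v
  Val≥-*-split {s /2^ e} {t /2^ f} d
    with 2^∣*-split e (suc f) (residue s N) (residue t N)
           (subst (λ k → 2^ k ∣ℤ 2^ 1 ℤ.* (residue s N ℤ.* residue t N)) (sym (ℕ.+-suc e f))
             (2^*-mono-∣ 1 (e + f) {suc (e + f)} {residue s N ℤ.* residue t N} refl
                (2^∣residue-raise (s *ℤ₂ t) (ℕ.n≤1+n (e + f)) d)))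
    where N = suc (e + f)
  ... | inj₁ p = inj₁ (2^∣residue-lower s (ℕ.≤-trans (ℕ.m≤m+n e f) (ℕ.n≤1+n _)) p)
  ... | inj₂ p = inj₂ (2^∣residue-lower t (s≤s (ℕ.m≤n+m f e)) p)

  Val≥0-1 : Val≥ 0 1ℚ₂
  Val≥0-1 = divides (+ 1) refl

  ¬Val≥1-1 : ¬ Val≥ 1 1ℚ₂
  ¬Val≥1-1 d = contradiction (∣⇒∣ᵤ d) (ℕ.>⇒∤ (s≤s (s≤s z≤n)))

  v₂>0⇒Val≥1 : ∀ {u} → v₂>0 u → Val≥ 1 u
  v₂>0⇒Val≥1 (_ , infinite {u} u≈0 , _) =
    Val≥-resp-≈ {1} {0ℚ₂} {u} (≈ℚ₂-sym {u} {0ℚ₂} u≈0) (divides 0ℤ refl)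
  v₂>0⇒Val≥1 (_ , finite {t} {e} j d _ , lt) =
    2^∣residue-lower t e<j (∣-trans (2^-mono-∣ e<j) d)
    where
    e<j : e < j
    e<j = ℤ.drop‿+<+ (subst₂ ℤ._<_ (ℤ.+-identityˡ (+ e))
      (let open ℤS in solve 2 (λ j e → j :- e :+ e := j) refl (+ j) (+ e))
      (ℤ.+-monoˡ-< (+ e) (Strict.[<]-injective lt)))

  -- The valuation of an arbitrary `u` cannot be computed, but failure at level `e + 1` bounds a
  -- downward search through decidable divisibilities. It stops at an exact power `j ≤ e`, at the
  -- latest at `j = 0`.
  ¬Val≥1⇒v₂≤0 : ∀ {u} → ¬ Val≥ 1 u → v₂≤0 u
  ¬Val≥1⇒v₂≤0 {t /2^ e} ¬d with least e ¬d
    where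
    least : ∀ m → ¬ (2^ (suc m) ∣ℤ residue t (suc m)) →
            ∃ λ j → j ≤ m × 2^ j ∣ℤ residue t j × ¬ (2^ (suc j) ∣ℤ residue t (suc j))
    least zero    ¬d = 0 , z≤n , 2^0-∣ _ , ¬d
    least (suc m) ¬d with 2^ (suc m) ∣ℤ? residue t (suc m)
    ... | yes d = suc m , ℕ.≤-refl , d , ¬d
    ... | no ¬d′ with least m ¬d′
    ... | j , j≤m , r = j , ℕ.m≤n⇒m≤1+n j≤m , r
  ... | j , j≤e , d , ¬d′ = _ , finite j d ¬d′ , NonStrict.[ subst (+ j ℤ.- + e ℤ.≤_) (ℤ.+-inverseʳ (+ e))
          (ℤ.+-monoˡ-≤ (ℤ.- (+ e)) (ℤ.+≤+ j≤e)) ]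

  Val≥-weaken : ∀ {k u} → Val≥ (suc k) u → Val≥ k u
  Val≥-weaken {k} {t /2^ e} d =
    2^∣residue-lower t (ℕ.n≤1+n (k + e)) (∣-trans (2^-mono-∣ (ℕ.n≤1+n (k + e))) d)

  -ℚ₂-cong : ∀ {u v} → u ≈ℚ₂ v → -ℚ₂ u ≈ℚ₂ -ℚ₂ v
  -ℚ₂-cong {s /2^ e} {t /2^ f} p n = subst (2^ n ∣ℤ_)
    (solve 4 (λ e f s t → :- (f :* s :- e :* t) := f :* (:- s) :- e :* (:- t)) refl
      (2^ e) (2^ f) (residue s n) (residue t n))
    (∣m⇒∣-m (p n))
    where open ℤS

  -- Natural multiples in ℚ₂ and truncation of the digit expansion.

  infixr 7 _·_

  -- Acting on the numerator alone keeps the exponent fixed, whereas repeated addition in ℚ₂ would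
  -- enlarge it.
  _·_ : ℕ → ℚ₂ → ℚ₂
  n · (t /2^ e) = (fromℤ (+ n) *ℤ₂ t) /2^ e

  0·-≈ : ∀ u → 0ℚ₂ ≈ℚ₂ 0 · u
  0·-≈ (t /2^ e) n = divides 0ℤ
    (solve 2 (λ p r → p :* con (+ 0) :- con (+ 1) :* (con (+ 0) :* r) := con (+ 0)) refl (2^ e) (residue t n))
    where open ℤS

  suc·-≈ : ∀ m u → u +ℚ₂ m · u ≈ℚ₂ suc m · u
  suc·-≈ m (t /2^ e) n = divides 0ℤ (trans
    (cong (λ w → 2^ e ℤ.* (2^ e ℤ.* residue t n ℤ.+ 2^ e ℤ.* (+ m ℤ.* residue t n))
                ℤ.- w ℤ.* (+ suc m ℤ.* residue t n)) (2^-+ e e))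
    (solve 3 (λ p m r → p :* (p :* r :+ p :* (m :* r)) :- p :* p :* ((con (+ 1) :+ m) :* r) := con (+ 0))
      refl (2^ e) (+ m) (residue t n)))
    where open ℤS

  ·-cong : ∀ m {u v} → u ≈ℚ₂ v → m · u ≈ℚ₂ m · v
  ·-cong m {s /2^ e} {t /2^ f} p n = subst (2^ n ∣ℤ_)
    (solve 5 (λ m e f s t → m :* (f :* s :- e :* t) := f :* (m :* s) :- e :* (m :* t)) refl
      (+ m) (2^ e) (2^ f) (residue s n) (residue t n))
    (∣n⇒∣m*n (+ m) (p n))
    where open ℤS

  2^·-cancel : ∀ t e → (2 ℕ.^ e) · (t /2^ e) ≈ℚ₂ t /2^ 0
  2^·-cancel t e n = divides 0ℤ
    (solve 2 (λ p r → con (+ 1) :* (p :* r) :- p :* r := con (+ 0)) refl (2^ e) (residue t n))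
    where open ℤS

  Val≥-2^· : ∀ e k u → Val≥ (e + k) ((2 ℕ.^ e) · u) → Val≥ k u
  Val≥-2^· e k (t /2^ g) d = 2^∣residue-lower t
    (subst (k + g ≤_) (sym (ℕ.+-assoc e k g)) (ℕ.m≤n+m (k + g) e))
    (2^*-cancel-∣ e (k + g) (ℕ.+-assoc e k g) d)

  -- Digits 0 to `e` are removed, hence the `e + 1`: after division by 2ᵉ these are the digits of
  -- index at most 0, and a valuation of at least 1 remains.
  Val≥-sub-digitSum : ∀ t e → Val≥ (e + 1) ((t /2^ 0) +ℚ₂ -ℚ₂ (digitSum t (suc e) · 1ℚ₂))
  Val≥-sub-digitSum t e = subst (λ N → 2^ N ∣ℤ 2^ 0 ℤ.* residue t N ℤ.+ 2^ 0 ℤ.* ℤ.- (+ D ℤ.* + 1))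
    (sym (trans (ℕ.+-identityʳ (e + 1)) (ℕ.+-comm e 1)))
    (subst (2^ (suc e) ∣ℤ_)
      (solve 2 (λ r D → r :- D := con (+ 1) :* r :+ con (+ 1) :* :- (D :* con (+ 1))) refl (residue t (suc e)) (+ D))
      (proj₂ (digitSum-correct t (suc e))))
    where
    open ℤS
    D = digitSum t (suc e)

-- Rational arithmetic for the estimates.

module RealNumbers where
  open ≡ using (refl; sym; trans; cong; cong₂; subst; subst₂)
  open ℚ-Lemmas
  open import Algebra.Definitions.RawMonoid ℚ.+-0-rawMonoid using () renaming (_×_ to _×ℚ_)
  open import Algebra.Definitions.RawMonoid (RawRing.+-rawMonoid ℝ-rawRing) using () renaming (_×_ to _×ℝ_)

  -- Because `_/_` reduces to lowest terms, the identity is checked on unnormalised representatives.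
  /-*-cancel : ∀ i d .{{_ : ℕ.NonZero d}} → (i ℚ./ d) ℚ.* (+ d ℚ./ 1) ≡ i ℚ./ 1
  /-*-cancel i d@(suc d-1) = ℚ.toℚᵘ-injective (begin
    ℚ.toℚᵘ ((i ℚ./ d) ℚ.* (+ d ℚ./ 1))
      ≈⟨ ℚ.toℚᵘ-homo-* (i ℚ./ d) (+ d ℚ./ 1) ⟩
    ℚ.toℚᵘ (i ℚ./ d) ℚᵘ.* ℚ.toℚᵘ (+ d ℚ./ 1)
      ≈⟨ ℚᵘ.*-cong (ℚ.toℚᵘ-fromℚᵘ (ℚᵘ.mkℚᵘ i d-1)) (ℚ.toℚᵘ-fromℚᵘ (ℚᵘ.mkℚᵘ (+ d) 0)) ⟩
    ℚᵘ.mkℚᵘ i d-1 ℚᵘ.* ℚᵘ.mkℚᵘ (+ d) 0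
      ≈⟨ ℚᵘ.*≡* (trans (ℤ.*-identityʳ (i ℤ.* + d)) (cong (λ k → i ℤ.* + suc k) (sym (ℕ.*-identityʳ d-1)))) ⟩
    ℚᵘ.mkℚᵘ i 0
      ≈⟨ ℚ.toℚᵘ-fromℚᵘ (ℚᵘ.mkℚᵘ i 0) ⟨
    ℚ.toℚᵘ (i ℚ./ 1)                            ∎)
    where open ℚᵘ.≃-Reasoning

  /1-homo-+ : ∀ i j → (i ℤ.+ j) ℚ./ 1 ≡ i ℚ./ 1 ℚ.+ j ℚ./ 1
  /1-homo-+ i j = sym (ℚ.toℚᵘ-injective (begin
    ℚ.toℚᵘ (i ℚ./ 1 ℚ.+ j ℚ./ 1)
      ≈⟨ ℚ.toℚᵘ-homo-+ (i ℚ./ 1) (j ℚ./ 1) ⟩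
    ℚ.toℚᵘ (i ℚ./ 1) ℚᵘ.+ ℚ.toℚᵘ (j ℚ./ 1)
      ≈⟨ ℚᵘ.+-cong (ℚ.toℚᵘ-fromℚᵘ (ℚᵘ.mkℚᵘ i 0)) (ℚ.toℚᵘ-fromℚᵘ (ℚᵘ.mkℚᵘ j 0)) ⟩
    ℚᵘ.mkℚᵘ i 0 ℚᵘ.+ ℚᵘ.mkℚᵘ j 0
      ≈⟨ ℚᵘ.*≡* (let open ℤS in
           solve 2 (λ i j → (i :* con (+ 1) :+ j :* con (+ 1)) :* con (+ 1) := (i :+ j) :* con (+ 1)) refl i j) ⟩
    ℚᵘ.mkℚᵘ (i ℤ.+ j) 0
      ≈⟨ ℚ.toℚᵘ-fromℚᵘ (ℚᵘ.mkℚᵘ (i ℤ.+ j) 0) ⟨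
    ℚ.toℚᵘ ((i ℤ.+ j) ℚ./ 1)                    ∎))
    where open ℚᵘ.≃-Reasoning

  ×ℚ≡/1* : ∀ n q → n ×ℚ q ≡ (+ n ℚ./ 1) ℚ.* q
  ×ℚ≡/1* zero    q = sym (ℚ.*-zeroˡ q)
  ×ℚ≡/1* (suc n) q = trans (cong (q ℚ.+_) (×ℚ≡/1* n q))
    (trans (solve 2 (λ n q → q :+ n :* q := (con 1ℚ :+ n) :* q) refl (+ n ℚ./ 1) q)
           (cong (ℚ._* q) (sym (/1-homo-+ (+ 1) (+ n)))))
    where open ℚS

  -- Only repeated addition occurs here, so any additive map transports this description of the
  -- fraction m / d.
  ↧×q≡↥×1 : ∀ m d-1 .(c : Coprime m (suc d-1)) → suc d-1 ×ℚ mkℚ (+ m) d-1 c ≡ m ×ℚ 1ℚ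
  ↧×q≡↥×1 m d-1 c = trans (×ℚ≡/1* d q)
    (trans (ℚ.*-comm (+ d ℚ./ 1) q)
    (trans (cong (ℚ._* (+ d ℚ./ 1)) (sym (ℚ.↥p/↧p≡p q)))
    (trans (/-*-cancel (+ m) d)
    (trans (sym (ℚ.*-identityʳ (+ m ℚ./ 1))) (sym (×ℚ≡/1* m 1ℚ))))))
    where d = suc d-1; q = mkℚ (+ m) d-1 c

  ∣p∣≤∣suc×p∣ : ∀ n p → ℚ.∣ p ∣ ℚ.≤ ℚ.∣ suc n ×ℚ p ∣
  ∣p∣≤∣suc×p∣ n p = subst₂ ℚ._≤_ (ℚ.*-identityˡ ℚ.∣ p ∣)
    (trans (sym (ℚ.∣p*q∣≡∣p∣*∣q∣ k p)) (cong ℚ.∣_∣ (sym (×ℚ≡/1* (suc n) p))))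
    (ℚ.*-monoʳ-≤-nonNeg ℚ.∣ p ∣ {{ℚ.∣-∣-nonNeg p}}
      (subst (1ℚ ℚ.≤_) (sym (ℚ.0≤p⇒∣p∣≡p (ℚ.≤-trans (ℚ.nonNegative⁻¹ 1ℚ) 1≤k))) 1≤k))
    where
    k = + suc n ℚ./ 1
    1≤k : 1ℚ ℚ.≤ k
    1≤k = subst₂ ℚ._≤_ (ℚ.+-identityʳ 1ℚ) (sym (/1-homo-+ (+ 1) (+ n)))
      (ℚ.+-monoʳ-≤ 1ℚ (ℚ.nonNegative⁻¹ (+ n ℚ./ 1) {{ℚ.normalize-nonNeg n 1}}))

  ×ℚ-distrib-sub : ∀ n p q → n ×ℚ (p ℚ.- q) ≡ n ×ℚ p ℚ.- n ×ℚ q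
  ×ℚ-distrib-sub n p q = trans (×ℚ≡/1* n (p ℚ.- q))
    (trans (solve 3 (λ n p q → n :* (p :- q) := n :* p :- n :* q) refl (+ n ℚ./ 1) p q)
      (sym (cong₂ ℚ._-_ (×ℚ≡/1* n p) (×ℚ≡/1* n q))))
    where open ℚS

  p≤∣p∣ : ∀ p → p ℚ.≤ ℚ.∣ p ∣
  p≤∣p∣ p with ℚ.≤-total 0ℚ p
  ... | inj₁ 0≤p = ℚ.≤-reflexive (sym (ℚ.0≤p⇒∣p∣≡p 0≤p))
  ... | inj₂ p≤0 = ℚ.≤-trans p≤0 (ℚ.0≤∣p∣ p)

  -p≤∣p∣ : ∀ p → ℚ.- p ℚ.≤ ℚ.∣ p ∣
  -p≤∣p∣ p = subst (ℚ.- p ℚ.≤_) (ℚ.∣-p∣≡∣p∣ p) (p≤∣p∣ (ℚ.- p))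

  ∣∣-elim : ∀ (P : ℚ → Set) p → P p → P (ℚ.- p) → P ℚ.∣ p ∣
  ∣∣-elim P p Pp P-p with ℚ.∣p∣≡p∨∣p∣≡-p p
  ... | inj₁ eq = subst P (sym eq) Pp
  ... | inj₂ eq = subst P (sym eq) P-p

  ∣p-q∣<ε⇒p<q+ε : ∀ {p q ε} → ℚ.∣ p ℚ.- q ∣ ℚ.< ε → p ℚ.< q ℚ.+ ε
  ∣p-q∣<ε⇒p<q+ε {p} {q} {ε} lt = subst (ℚ._< q ℚ.+ ε)
    (solve 2 (λ p q → q :+ (p :- q) := p) refl p q)
    (ℚ.+-monoʳ-< q (ℚ.≤-<-trans (p≤∣p∣ (p ℚ.- q)) lt))
    where open ℚS

  +≤⇒≤- : ∀ {p q r} → p ℚ.+ q ℚ.≤ r → q ℚ.≤ r ℚ.- p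
  +≤⇒≤- {p} {q} {r} le = subst (ℚ._≤ r ℚ.- p)
    (solve 2 (λ p q → p :+ q :- p := q) refl p q) (ℚ.+-monoˡ-≤ (ℚ.- p) le)
    where open ℚS

  ≤-⇒+≤ : ∀ {p q r} → q ℚ.≤ r ℚ.- p → p ℚ.+ q ℚ.≤ r
  ≤-⇒+≤ {p} {q} {r} le = subst (p ℚ.+ q ℚ.≤_)
    (solve 2 (λ p r → p :+ (r :- p) := r) refl p r) (ℚ.+-monoʳ-≤ p le)
    where open ℚS

  -- Equality, positivity and signs of Cauchy reals.

  eventually-∩ : ∀ {P Q} → Eventually P → Eventually Q → Eventually (P ∩ Q)
  eventually-∩ (M , p) (N , q) = M ℕ.⊔ N , λ n le →
    p n (ℕ.m⊔n≤o⇒m≤o M N le) , q n (ℕ.m⊔n≤o⇒n≤o M N le)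

  eventually-map : ∀ {P Q} → (∀ n → P n → Q n) → Eventually P → Eventually Q
  eventually-map f (N , p) = N , λ n le → f n (p n le)

  ¬eventually-⊥ : ¬ Eventually (λ _ → ⊥)
  ¬eventually-⊥ (N , p) = p N ℕ.≤-refl

  ≗⇒≈ℝ : ∀ {x y} → (∀ n → seq x n ≡ seq y n) → x ≈ℝ y
  ≗⇒≈ℝ {x} {y} eq ε ε>0 = 0 , λ n _ →
    subst (ℚ._< ε) (sym (trans (cong (λ z → ℚ.∣ z ℚ.- seq y n ∣) (eq n)) (cong ℚ.∣_∣ (ℚ.+-inverseʳ (seq y n))))) ε>0

  ≈ℝ-refl : ∀ x → x ≈ℝ x
  ≈ℝ-refl x = ≗⇒≈ℝ {x} {x} λ _ → refl

  ≈ℝ-sym : ∀ {x y} → x ≈ℝ y → y ≈ℝ x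
  ≈ℝ-sym {x} {y} p ε ε>0 =
    eventually-map (λ n → subst (ℚ._< ε) (∣∣-sym (seq x n) (seq y n))) (p ε ε>0)

  ∣+∣<half+half : ∀ p q ε → ℚ.∣ p ∣ ℚ.< ½ ℚ.* ε → ℚ.∣ q ∣ ℚ.< ½ ℚ.* ε → ℚ.∣ p ℚ.+ q ∣ ℚ.< ε
  ∣+∣<half+half p q ε a b = subst (ℚ.∣ p ℚ.+ q ∣ ℚ.<_) (half+half ε)
    (ℚ.≤-<-trans (ℚ.∣p+q∣≤∣p∣+∣q∣ p q) (ℚ.+-mono-< a b))

  ≈ℝ-trans : ∀ {x y z} → x ≈ℝ y → y ≈ℝ z → x ≈ℝ z
  ≈ℝ-trans {x} {y} {z} p q ε ε>0 = eventually-map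
    (λ n (a , b) → subst (λ w → ℚ.∣ w ∣ ℚ.< ε)
      (solve 3 (λ x y z → (x :- y) :+ (y :- z) := x :- z) refl (seq x n) (seq y n) (seq z n))
      (∣+∣<half+half (seq x n ℚ.- seq y n) (seq y n ℚ.- seq z n) ε a b))
    (eventually-∩ (p _ (half>0 ε ε>0)) (q _ (half>0 ε ε>0)))
    where open ℚS

  +ℝ-cong : ∀ {x x′ y y′} → x ≈ℝ x′ → y ≈ℝ y′ → x +ℝ y ≈ℝ x′ +ℝ y′
  +ℝ-cong {x} {x′} {y} {y′} p q ε ε>0 = eventually-map
    (λ n (a , b) → subst (λ w → ℚ.∣ w ∣ ℚ.< ε) (+-sub (seq x n) (seq x′ n) (seq y n) (seq y′ n))
      (∣+∣<half+half (seq x n ℚ.- seq x′ n) (seq y n ℚ.- seq y′ n) ε a b))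
    (eventually-∩ (p _ (half>0 ε ε>0)) (q _ (half>0 ε ε>0)))

  -ℝ-cong : ∀ {x y} → x ≈ℝ y → -ℝ x ≈ℝ -ℝ y
  -ℝ-cong {x} {y} p ε ε>0 = eventually-map
    (λ n → subst (ℚ._< ε) (trans (sym (ℚ.∣-p∣≡∣p∣ (seq x n ℚ.- seq y n)))
      (cong ℚ.∣_∣ (ℚ.neg-distrib-+ (seq x n) (ℚ.- seq y n))))) (p ε ε>0)

  -- A one-place form of `_<ℝ_`: being a condition on a single real, it can be pulled back along an
  -- embedding to a set of positive elements of the field.
  Positiveℝ : ℝ → Set
  Positiveℝ x = ∃ λ ε → 0ℚ ℚ.< ε × Eventually λ n → ε ℚ.≤ seq x n

  <ℝ⇒positive : ∀ {x y} → x <ℝ y → Positiveℝ (y -ℝ x)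
  <ℝ⇒positive (ε , ε>0 , ev) = ε , ε>0 , eventually-map (λ _ → +≤⇒≤-) ev

  positive⇒<ℝ : ∀ {x y} → Positiveℝ (y -ℝ x) → x <ℝ y
  positive⇒<ℝ (ε , ε>0 , ev) = ε , ε>0 , eventually-map (λ _ → ≤-⇒+≤) ev

  -- Half of the gap is spent on the distance between the two sequences.
  positive-resp-≈ : ∀ {x y} → x ≈ℝ y → Positiveℝ x → Positiveℝ y
  positive-resp-≈ {x} {y} x≈y (ε , ε>0 , ev) = ½ ℚ.* ε , half>0 ε ε>0 , eventually-map
    (λ n (ε≤x , close) → subst₂ ℚ._≤_
      (trans (cong (ℚ._- (½ ℚ.* ε)) (sym (half+half ε)))
        (solve 1 (λ h → h :+ h :- h := h) refl (½ ℚ.* ε)))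
      (solve 2 (λ y h → y :+ h :- h := y) refl (seq y n) (½ ℚ.* ε))
      (ℚ.+-monoˡ-≤ (ℚ.- (½ ℚ.* ε)) (ℚ.<⇒≤ (ℚ.≤-<-trans ε≤x (∣p-q∣<ε⇒p<q+ε close)))))
    (eventually-∩ ev (x≈y _ (half>0 ε ε>0)))
    where open ℚS

  positive-+ : ∀ {x y} → Positiveℝ x → Positiveℝ y → Positiveℝ (x +ℝ y)
  positive-+ (ε , ε>0 , ev) (δ , δ>0 , ev′) = ε ℚ.+ δ , ℚ.+-mono-< ε>0 δ>0 ,
    eventually-map (λ n (p , q) → ℚ.+-mono-≤ p q) (eventually-∩ ev ev′)

  positive-* : ∀ {x y} → Positiveℝ x → Positiveℝ y → Positiveℝ (x *ℝ y)
  positive-* {x} {y} (ε , ε>0 , ev) (δ , δ>0 , ev′) = ε ℚ.* δ ,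
    subst (ℚ._< ε ℚ.* δ) (ℚ.*-zeroʳ ε) (ℚ.*-monoʳ-<-pos ε {{ℚ.positive ε>0}} δ>0) ,
    eventually-map (λ n (p , q) → ℚ.≤-trans
      (ℚ.*-monoʳ-≤-nonNeg δ {{ℚ.nonNegative (ℚ.<⇒≤ δ>0)}} p)
      (ℚ.*-monoˡ-≤-nonNeg (seq x n) {{ℚ.nonNegative (ℚ.≤-trans (ℚ.<⇒≤ ε>0) p)}} q))
    (eventually-∩ ev ev′)

  positive-asym : ∀ {x} → Positiveℝ x → ¬ Positiveℝ (-ℝ x)
  positive-asym {x} (ε , ε>0 , ev) (δ , δ>0 , ev′) = ¬eventually-⊥ (eventually-map
    (λ n (p , q) → ℚ.<-irrefl refl (ℚ.<-≤-trans (ℚ.+-mono-< ε>0 δ>0)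
      (subst (ε ℚ.+ δ ℚ.≤_) (ℚ.+-inverseʳ (seq x n)) (ℚ.+-mono-≤ p q))))
    (eventually-∩ ev ev′))

  half≤ : ∀ {κ a b} → κ ℚ.≤ a → a ℚ.< b ℚ.+ ½ ℚ.* κ → ½ ℚ.* κ ℚ.≤ b
  half≤ {κ} {a} {b} κ≤a a<b+η = subst₂ ℚ._≤_
    (trans (cong (ℚ._- (½ ℚ.* κ)) (sym (half+half κ))) (solve 1 (λ h → h :+ h :- h := h) refl (½ ℚ.* κ)))
    (solve 2 (λ y h → y :+ h :- h := y) refl b (½ ℚ.* κ))
    (ℚ.+-monoˡ-≤ (ℚ.- (½ ℚ.* κ)) (ℚ.<⇒≤ (ℚ.≤-<-trans κ≤a a<b+η)))
    where open ℚS

  -- If |x| were below κ, then |yx| < Bκ = u / 2; together with the distance from `xy` to `u`, which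
  -- is also below u / 2, this would give u < u.
  ∣*-u∣<half⇒≤∣∣ : ∀ {x y u B κ} → 0ℚ ℚ.< B → B ℚ.* κ ≡ ½ ℚ.* u → ℚ.∣ u ∣ ≡ u →
                   ℚ.∣ y ∣ ℚ.≤ B → ℚ.∣ x ℚ.* y ℚ.- u ∣ ℚ.< ½ ℚ.* u → κ ℚ.≤ ℚ.∣ x ∣
  ∣*-u∣<half⇒≤∣∣ {x} {y} {u} {B} {κ} B>0 Bκ≡½u ∣u∣≡u y≤B close with κ ℚ.≤? ℚ.∣ x ∣
  ... | yes p = p
  ... | no ¬p = ⊥-elim (ℚ.<-irrefl ∣u∣≡u (subst (λ w → ℚ.∣ w ∣ ℚ.< u)
        (solve 3 (λ x y u → (u :- x :* y) :+ y :* x := u) refl x y u)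
        (∣+∣<half+half (u ℚ.- x ℚ.* y) (y ℚ.* x) u
          (subst (ℚ._< ½ ℚ.* u) (∣∣-sym (x ℚ.* y) u) close)
          (subst (ℚ.∣ y ℚ.* x ∣ ℚ.<_) Bκ≡½u (∣*∣< y x B>0 y≤B (ℚ.≰⇒> ¬p))))))
    where open ℚS

  -- One term taken beyond both thresholds has absolute value at least κ, and later terms differ
  -- from it by less than κ / 2; they keep its sign and a gap of κ / 2.
  far⇒sign : ∀ {x κ} → 0ℚ ℚ.< κ → Eventually (λ n → κ ℚ.≤ ℚ.∣ seq x n ∣) → Positiveℝ x ⊎ Positiveℝ (-ℝ x)
  far⇒sign {x} {κ} κ>0 (M , far) with cauchy x (½ ℚ.* κ) (half>0 κ κ>0)
  ... | N , close with far (M ℕ.⊔ N) (ℕ.m≤m⊔n M N) | ℚ.∣p∣≡p∨∣p∣≡-p (seq x (M ℕ.⊔ N))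
  ... | κ≤ | inj₁ eq = inj₁ (½ ℚ.* κ , half>0 κ κ>0 , N , λ n N≤n →
    half≤ (subst (κ ℚ.≤_) eq κ≤) (∣p-q∣<ε⇒p<q+ε (close (M ℕ.⊔ N) n (ℕ.m≤n⊔m M N) N≤n)))
  ... | κ≤ | inj₂ eq = inj₂ (½ ℚ.* κ , half>0 κ κ>0 , N , λ n N≤n →
    half≤ (subst (κ ℚ.≤_) eq κ≤) (∣p-q∣<ε⇒p<q+ε (subst (λ w → ℚ.∣ w ∣ ℚ.< ½ ℚ.* κ)
      (let open ℚS in solve 2 (λ a b → a :- b := :- b :- :- a) refl (seq x n) (seq x (M ℕ.⊔ N)))
      (close n (M ℕ.⊔ N) N≤n (ℕ.m≤n⊔m M N)))))

  -- A bound on y keeps x away from 0, and a single late enough term then decides the sign.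
  product⇒sign : ∀ {x y u} → 0ℚ ℚ.< u → x *ℝ y ≈ℝ fromℚ u → Positiveℝ x ⊎ Positiveℝ (-ℝ x)
  product⇒sign {x} {y} {u} u>0 xy≈u =
    let B , B>0 , y≤B = bound y
    in far⇒sign {x} (by>0 u B B>0 u>0) (eventually-map
         (λ n (p , q) → ∣*-u∣<half⇒≤∣∣ {seq x n} {seq y n} B>0 (*-by u B B>0) (ℚ.0≤p⇒∣p∣≡p (ℚ.<⇒≤ u>0)) p q)
         (eventually-∩ y≤B (xy≈u (½ ℚ.* u) (half>0 u u>0))))

  -- Distances to two rationals, and bounds on real absolute values.

  closer-above : ∀ {x c c′ mid} → c ℚ.< c′ → mid ℚ.+ mid ≡ c ℚ.+ c′ → fromℚ mid <ℝ x →
                 ∣ x -ℝ fromℚ c′ ∣ℝ <ℝ ∣ x -ℝ fromℚ c ∣ℝ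
  closer-above {x} {c} {c′} {mid} c<c′ mid-eq (ε , ε>0 , ev) = δ , δ>0 , eventually-map
    (λ n p → ℚ.≤-trans
      (∣∣-elim (λ w → w ℚ.+ δ ℚ.≤ seq x n ℚ.- c) (seq x n ℚ.- c′)
        (ℚ.≤-trans (ℚ.+-monoʳ-≤ (seq x n ℚ.- c′) (ℚ.p⊓q≤p (c′ ℚ.- c) ε))
          (ℚ.≤-reflexive (solve 3 (λ x c c′ → x :- c′ :+ (c′ :- c) := x :- c) refl (seq x n) c c′)))
        (ℚ.≤-trans (ℚ.+-monoʳ-≤ (ℚ.- (seq x n ℚ.- c′)) (ℚ.p⊓q≤q (c′ ℚ.- c) ε))
          (below n p)))
      (p≤∣p∣ (seq x n ℚ.- c))) ev
    where
    open ℚS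
    -- One gap must serve both signs of x - c′. To the right of c′ the gain is exactly c′ - c; to
    -- its left it is twice the distance from x to the midpoint, hence at least ε.
    δ = (c′ ℚ.- c) ℚ.⊓ ε
    c′-c>0 : 0ℚ ℚ.< c′ ℚ.- c
    c′-c>0 = subst (ℚ._< c′ ℚ.- c) (ℚ.+-inverseʳ c) (ℚ.+-monoˡ-< (ℚ.- c) c<c′)
    δ>0 : 0ℚ ℚ.< δ
    δ>0 with ℚ.⊓-sel (c′ ℚ.- c) ε
    ... | inj₁ eq = subst (0ℚ ℚ.<_) (sym eq) c′-c>0
    ... | inj₂ eq = subst (0ℚ ℚ.<_) (sym eq) ε>0
    below : ∀ n → mid ℚ.+ ε ℚ.≤ seq x n → ℚ.- (seq x n ℚ.- c′) ℚ.+ ε ℚ.≤ seq x n ℚ.- c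
    below n p = begin
      ℚ.- (seq x n ℚ.- c′) ℚ.+ ε
        ≡⟨ solve 4 (λ x c c′ ε → :- (x :- c′) :+ ε := (c :+ c′) :+ (ε :- (x :+ c))) refl (seq x n) c c′ ε ⟩
      (c ℚ.+ c′) ℚ.+ (ε ℚ.- (seq x n ℚ.+ c))
        ≡⟨ cong (ℚ._+ (ε ℚ.- (seq x n ℚ.+ c))) mid-eq ⟨
      (mid ℚ.+ mid) ℚ.+ (ε ℚ.- (seq x n ℚ.+ c))
        ≡⟨ solve 4 (λ x c m ε → (m :+ m) :+ (ε :- (x :+ c)) := (m :+ ε) :+ (m :- (x :+ c))) refl (seq x n) c mid ε ⟩
      (mid ℚ.+ ε) ℚ.+ (mid ℚ.- (seq x n ℚ.+ c))
        ≤⟨ ℚ.+-monoˡ-≤ (mid ℚ.- (seq x n ℚ.+ c)) p ⟩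
      seq x n ℚ.+ (mid ℚ.- (seq x n ℚ.+ c))
        ≡⟨ solve 3 (λ x c m → x :+ (m :- (x :+ c)) := m :- c) refl (seq x n) c mid ⟩
      mid ℚ.- c
        ≤⟨ ℚ.+-monoˡ-≤ (ℚ.- c) mid≤x ⟩
      seq x n ℚ.- c ∎
      where
      open ℚ.≤-Reasoning
      mid≤x : mid ℚ.≤ seq x n
      mid≤x = ℚ.≤-trans (ℚ.≤-reflexive (sym (ℚ.+-identityʳ mid)))
        (ℚ.≤-trans (ℚ.+-monoʳ-≤ mid (ℚ.<⇒≤ ε>0)) p)

  -- The reflection x ↦ -x turns this into `closer-above`.
  closer-below : ∀ {x c c′ mid} → c′ ℚ.< c → mid ℚ.+ mid ≡ c ℚ.+ c′ → x <ℝ fromℚ mid →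
                 ∣ x -ℝ fromℚ c′ ∣ℝ <ℝ ∣ x -ℝ fromℚ c ∣ℝ
  closer-below {x} {c} {c′} {mid} c′<c mid-eq (ε , ε>0 , ev) =
    let δ , δ>0 , ev′ = closer-above { -ℝ x} {ℚ.- c} {ℚ.- c′} {ℚ.- mid} (ℚ.neg-antimono-< c′<c)
          (trans (sym (ℚ.neg-distrib-+ mid mid)) (trans (cong ℚ.-_ mid-eq) (ℚ.neg-distrib-+ c c′)))
          (ε , ε>0 , eventually-map flip ev)
    in δ , δ>0 , eventually-map
         (λ n → subst₂ (λ a b → a ℚ.+ δ ℚ.≤ b) (reflect (seq x n) c′) (reflect (seq x n) c)) ev′
    where
    open ℚS
    flip : ∀ n → seq x n ℚ.+ ε ℚ.≤ mid → ℚ.- mid ℚ.+ ε ℚ.≤ ℚ.- seq x n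
    flip n p = subst (ℚ._≤ ℚ.- seq x n)
      (solve 2 (λ e m → :- (m :- e) := :- m :+ e) refl ε mid)
      (ℚ.neg-antimono-≤ (+≤⇒≤- (subst (ℚ._≤ mid) (ℚ.+-comm (seq x n) ε) p)))
    reflect : ∀ a b → ℚ.∣ ℚ.- a ℚ.- ℚ.- b ∣ ≡ ℚ.∣ a ℚ.- b ∣
    reflect a b = trans (cong ℚ.∣_∣ (sym (ℚ.neg-distrib-+ a (ℚ.- b)))) (ℚ.∣-p∣≡∣p∣ (a ℚ.- b))

  <ℝ⇒<ℝ∣∣ : ∀ {q x} → fromℚ q <ℝ x → fromℚ q <ℝ ∣ x ∣ℝ
  <ℝ⇒<ℝ∣∣ {x = x} (ε , ε>0 , ev) =
    ε , ε>0 , eventually-map (λ n p → ℚ.≤-trans p (p≤∣p∣ (seq x n))) ev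

  <ℝ-⇒<ℝ∣∣ : ∀ {q x} → fromℚ q <ℝ -ℝ x → fromℚ q <ℝ ∣ x ∣ℝ
  <ℝ-⇒<ℝ∣∣ {x = x} (ε , ε>0 , ev) =
    ε , ε>0 , eventually-map (λ n p → ℚ.≤-trans p (-p≤∣p∣ (seq x n))) ev

  -- If |x| exceeded q by δ, a late term with the negative sign would violate the lower bound, which
  -- has its own gap ε. So all late terms would be at least q + δ, against x ≤ q.
  ∣∣≤ℝ : ∀ {x q} → fromℚ (ℚ.- q) <ℝ x → x ≤ℝ fromℚ q → ∣ x ∣ℝ ≤ℝ fromℚ q
  ∣∣≤ℝ {x} {q} (ε , ε>0 , ev) x≤q (δ , δ>0 , ev′) = x≤q (δ , δ>0 , eventually-map
    (λ n (p , r) → case n p r) (eventually-∩ ev ev′))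
    where
    open ℚS
    case : ∀ n → ℚ.- q ℚ.+ ε ℚ.≤ seq x n → q ℚ.+ δ ℚ.≤ ℚ.∣ seq x n ∣ → q ℚ.+ δ ℚ.≤ seq x n
    case n p r with ℚ.∣p∣≡p∨∣p∣≡-p (seq x n)
    ... | inj₁ eq = subst (q ℚ.+ δ ℚ.≤_) eq r
    ... | inj₂ eq = ⊥-elim (ℚ.<-irrefl refl (ℚ.<-≤-trans (ℚ.+-mono-< ε>0 δ>0)
          (subst₂ ℚ._≤_ (solve 3 (λ q ε δ → (:- q :+ ε) :+ (q :+ δ) := ε :+ δ) refl q ε δ) (ℚ.+-inverseʳ (seq x n))
            (ℚ.+-mono-≤ p (subst (q ℚ.+ δ ℚ.≤_) eq r)))))

  -- Additive maps from ℚ to ℝ that send 1 to 1.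

  seq-× : ∀ n x k → seq (n ×ℝ x) k ≡ n ×ℚ seq x k
  seq-× zero    x k = refl
  seq-× (suc n) x k = cong (seq x k ℚ.+_) (seq-× n x k)

  ×ℝ-congʳ : ∀ n {x y} → x ≈ℝ y → n ×ℝ x ≈ℝ n ×ℝ y
  ×ℝ-congʳ zero    {x} {y} p = ≗⇒≈ℝ {fromℚ 0ℚ} {fromℚ 0ℚ} λ _ → refl
  ×ℝ-congʳ (suc n) {x} {y} p = +ℝ-cong {x} {y} {n ×ℝ x} {n ×ℝ y} p (×ℝ-congʳ n {x} {y} p)

  module _ (f : ℚ → ℝ) (+-homo : ∀ p q → f (p ℚ.+ q) ≈ℝ f p +ℝ f q) (0-homo : f 0ℚ ≈ℝ fromℚ 0ℚ)
           (-‿homo : ∀ p → f (ℚ.- p) ≈ℝ -ℝ f p) (1-homo : f 1ℚ ≈ℝ fromℚ 1ℚ) where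

    private
      f-× : ∀ n q → f (n ×ℚ q) ≈ℝ n ×ℝ f q
      f-× zero    q = 0-homo
      f-× (suc n) q = ≈ℝ-trans {f (q ℚ.+ n ×ℚ q)} {f q +ℝ f (n ×ℚ q)} {suc n ×ℝ f q} (+-homo q (n ×ℚ q))
        (+ℝ-cong {f q} {f q} {f (n ×ℚ q)} {n ×ℝ f q} (≈ℝ-refl (f q)) (f-× n q))

      -- Additivity gives d · f(m / d) = m. Multiplication by d ≥ 1 does not decrease absolute
      -- values, so the approximation of d · f(q) by m already bounds that of f(q) by q, with the
      -- same ε.
      nonNeg : ∀ m d-1 .(c : Coprime m (suc d-1)) → f (mkℚ (+ m) d-1 c) ≈ℝ fromℚ (mkℚ (+ m) d-1 c)
      nonNeg m d-1 c ε ε>0 = eventually-map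
        (λ n → ℚ.≤-<-trans (ℚ.≤-trans (∣p∣≤∣suc×p∣ d-1 (seq (f q) n ℚ.- q))
          (ℚ.≤-reflexive (cong ℚ.∣_∣ (trans (×ℚ-distrib-sub d (seq (f q) n) q)
            (cong₂ ℚ._-_ (sym (seq-× d (f q) n)) (trans (↧×q≡↥×1 m d-1 c) (sym (seq-× m (fromℚ 1ℚ) n)))))))))
        (d×fq≈m ε ε>0)
        where
        d = suc d-1
        q = mkℚ (+ m) d-1 c
        d×fq≈m : d ×ℝ f q ≈ℝ m ×ℝ fromℚ 1ℚ
        d×fq≈m = ≈ℝ-trans {d ×ℝ f q} {f (d ×ℚ q)} {m ×ℝ fromℚ 1ℚ}
          (≈ℝ-sym {f (d ×ℚ q)} {d ×ℝ f q} (f-× d q))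
          (subst (λ w → f w ≈ℝ m ×ℝ fromℚ 1ℚ) (sym (↧×q≡↥×1 m d-1 c))
            (≈ℝ-trans {f (m ×ℚ 1ℚ)} {m ×ℝ f 1ℚ} {m ×ℝ fromℚ 1ℚ} (f-× m 1ℚ)
              (×ℝ-congʳ m {f 1ℚ} {fromℚ 1ℚ} 1-homo)))

    homo⇒fromℚ : ∀ q → f q ≈ℝ fromℚ q
    homo⇒fromℚ (mkℚ (+ m) d-1 c)    = nonNeg m d-1 c
    homo⇒fromℚ (mkℚ -[1+ m ] d-1 c) =
      ≈ℝ-trans {f (ℚ.- q)} { -ℝ f q} { -ℝ fromℚ q} (-‿homo q) (-ℝ-cong {f q} {fromℚ q} (nonNeg (suc m) d-1 c))
      where q = mkℚ +[1+ m ] d-1 c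

open DyadicNumbers
open RealNumbers

-- Odd indices.

odd⇒1+2k : ∀ {n} → ¬ 2 ∣ n → ∃ λ k → n ≡ suc (k ℕ.* 2)
odd⇒1+2k {n} odd with n ℕ.% 2 in eq | ℕ.m%n<n n 2 | ℕ.m≡m%n+[m/n]*n n 2
... | 0           | _                   | n≡ = contradiction (ℕ.divides (n ℕ./ 2) n≡) odd
... | 1           | _                   | n≡ = n ℕ./ 2 , n≡
... | suc (suc _) | s≤s (s≤s ()) | _

¬2∣1+2k : ∀ k → ¬ 2 ∣ suc (k ℕ.* 2)
¬2∣1+2k k d = contradiction
  (ℕ.∣1⇒≡1 (ℕ.∣m+n∣m⇒∣n (≡.subst (2 ∣_) (ℕ.+-comm 1 (k ℕ.* 2)) d) (ℕ.divides k ≡.refl))) λ ()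

-- Algebra in the quadratic field.

module QuadraticFieldProperties {c ℓ} (K : QuadraticField c ℓ) where
  open QuadraticField K
  open RingProperties ring using (-0#≈0#; -‿involutive; -‿distribʳ-*)

  module ι = IsRingHomomorphism ι-homo

  private
    ι-morphism : ℚ.+-*-rawRing -Raw-AlmostCommutative⟶ fromCommutativeRing commutativeRing
    ι-morphism = record
      { ⟦_⟧ = ι ; +-homo = ι.+-homo ; *-homo = ι.*-homo ; -‿homo = ι.-‿homo
      ; 0-homo = ι.0#-homo ; 1-homo = ι.1#-homo }

    ι-≟ : ∀ p q → Maybe (ι p ≈ ι q)
    ι-≟ p q with p ℚ.≟ q
    ... | yes p≡q = just (ι.⟦⟧-cong p≡q)
    ... | no _    = nothing

  module S = RingSolver ℚ.+-*-rawRing (fromCommutativeRing commutativeRing) ι-morphism ι-≟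
  open S using (solve; _:=_; _:+_; _:*_; _:-_; :-_; con)

  x-y≈0⇒x≈y : ∀ {x y} → x - y ≈ 0# → x ≈ y
  x-y≈0⇒x≈y {x} {y} eq = trans (solve 2 (λ x y → x := (x :- y) :+ y) refl x y)
    (trans (+-congʳ eq) (+-identityˡ y))

  *-cancel-≈0 : ∀ {x y} → x ≉ 0# → x * y ≈ 0# → y ≈ 0#
  *-cancel-≈0 {x} {y} x≉0 xy≈0 = trans (sym (*-identityˡ y))
    (trans (*-congʳ (sym (⁻¹-inverseʳ x x≉0)))
    (trans (solve 3 (λ x x′ y → x :* x′ :* y := x′ :* (x :* y)) refl x (x ⁻¹) y)
    (trans (*-congˡ xy≈0) (zeroʳ (x ⁻¹)))))

  -- Ordered-field arithmetic from a set of positive elements with decidable sign.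

  module OrderedField {p}
    (Pos : Pred Carrier p)
    (pos-resp : ∀ {x y} → x ≈ y → Pos x → Pos y)
    (pos-+ : ∀ {x y} → Pos x → Pos y → Pos (x + y))
    (pos-* : ∀ {x y} → Pos x → Pos y → Pos (x * y))
    (pos-asym : ∀ {x} → Pos x → ¬ Pos (- x))
    (pos-ι : ∀ {q} → 0ℚ ℚ.< q → Pos (ι q))
    (sign : ∀ x → x ≈ 0# ⊎ Pos x ⊎ Pos (- x))
    where

    NonNeg : Pred Carrier _
    NonNeg x = x ≈ 0# ⊎ Pos x

    nonNeg-resp : ∀ {x y} → x ≈ y → NonNeg x → NonNeg y
    nonNeg-resp x≈y (inj₁ x≈0) = inj₁ (trans (sym x≈y) x≈0)
    nonNeg-resp x≈y (inj₂ x>0) = inj₂ (pos-resp x≈y x>0)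

    nonNeg+pos⇒pos : ∀ {x y} → NonNeg x → Pos y → Pos (x + y)
    nonNeg+pos⇒pos {x} {y} (inj₁ x≈0) y>0 = pos-resp (sym (trans (+-congʳ x≈0) (+-identityˡ y))) y>0
    nonNeg+pos⇒pos (inj₂ x>0) y>0 = pos-+ x>0 y>0

    nonNeg-+ : ∀ {x y} → NonNeg x → NonNeg y → NonNeg (x + y)
    nonNeg-+ {x} {y} x≥0 (inj₁ y≈0) = nonNeg-resp (sym (trans (+-congˡ y≈0) (+-identityʳ x))) x≥0
    nonNeg-+ x≥0 (inj₂ y>0) = inj₂ (nonNeg+pos⇒pos x≥0 y>0)

    nonNeg-* : ∀ {x y} → NonNeg x → NonNeg y → NonNeg (x * y)
    nonNeg-* {x} {y} (inj₁ x≈0) _ = inj₁ (trans (*-congʳ x≈0) (zeroˡ y))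
    nonNeg-* {x} {y} (inj₂ _) (inj₁ y≈0) = inj₁ (trans (*-congˡ y≈0) (zeroʳ x))
    nonNeg-* (inj₂ x>0) (inj₂ y>0) = inj₂ (pos-* x>0 y>0)

    ¬pos-0 : ∀ {x} → x ≈ 0# → ¬ Pos x
    ¬pos-0 x≈0 x>0 = pos-asym x>0 (pos-resp (trans x≈0 (trans (sym -0#≈0#) (-‿cong (sym x≈0)))) x>0)

    pos⇒≉0 : ∀ {x} → Pos x → x ≉ 0#
    pos⇒≉0 x>0 x≈0 = ¬pos-0 x≈0 x>0

    pos-≉0 : ∀ {x} → NonNeg x → x ≉ 0# → Pos x
    pos-≉0 (inj₁ x≈0) x≉0 = contradiction x≈0 x≉0
    pos-≉0 (inj₂ x>0) _   = x>0

    -- For identities that hold only modulo a relation e = 0: the ring solver checks y = r + ke with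
    -- an explicit multiplier k, and the positivity of r is shown separately.
    pos-certificate : ∀ {y r k e} → y ≈ r + k * e → e ≈ 0# → Pos r → Pos y
    pos-certificate {y} {r} {k} {e} y≈ e≈0 r>0 = pos-resp
      (sym (trans y≈ (trans (+-congˡ (trans (*-congˡ e≈0) (zeroʳ k))) (+-identityʳ r)))) r>0

    pos-*-cancel : ∀ {x y} → Pos x → Pos (x * y) → Pos y
    pos-*-cancel {x} {y} x>0 xy>0 with sign y
    ... | inj₁ y≈0        = contradiction xy>0 (¬pos-0 (trans (*-congˡ y≈0) (zeroʳ x)))
    ... | inj₂ (inj₁ y>0) = y>0
    ... | inj₂ (inj₂ y<0) = contradiction (pos-resp (sym (-‿distribʳ-* x y)) (pos-* x>0 y<0)) (pos-asym xy>0)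

    abstract
      -- Blocked from unfolding: later arguments rely on the value being non-negative and equal to
      -- `x` or `- x`.
      absolute : ∀ x → ∃ λ a → NonNeg a × (a ≈ x ⊎ a ≈ - x)
      absolute x with sign x
      ... | inj₁ x≈0        = 0# , inj₁ refl , inj₁ (sym x≈0)
      ... | inj₂ (inj₁ x>0) = x , inj₂ x>0 , inj₁ refl
      ... | inj₂ (inj₂ x<0) = - x , inj₂ x<0 , inj₂ refl

    ∣_∣ : Carrier → Carrier
    ∣ x ∣ = proj₁ (absolute x)

    ∣∣-nonNeg : ∀ x → NonNeg ∣ x ∣
    ∣∣-nonNeg x = proj₁ (proj₂ (absolute x))

    ∣∣-± : ∀ x → ∣ x ∣ ≈ x ⊎ ∣ x ∣ ≈ - x
    ∣∣-± x = proj₂ (proj₂ (absolute x))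

    ∣∣≈0⇒≈0 : ∀ {x} → ∣ x ∣ ≈ 0# → x ≈ 0#
    ∣∣≈0⇒≈0 {x} eq with ∣∣-± x
    ... | inj₁ ∣x∣≈x  = trans (sym ∣x∣≈x) eq
    ... | inj₂ ∣x∣≈-x = trans (sym (-‿involutive x)) (trans (-‿cong (trans (sym ∣x∣≈-x) eq)) -0#≈0#)

    nonNeg-antisym : ∀ {x y} → NonNeg x → NonNeg y → x ≈ - y → x ≈ y
    nonNeg-antisym {x} {y} _ (inj₁ y≈0) x≈-y = trans x≈-y (trans (trans (-‿cong y≈0) -0#≈0#) (sym y≈0))
    nonNeg-antisym {x} {y} (inj₁ x≈0) (inj₂ y>0) x≈-y =
      contradiction y>0 (¬pos-0 (trans (sym (-‿involutive y)) (trans (-‿cong (trans (sym x≈-y) x≈0)) -0#≈0#)))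
    nonNeg-antisym (inj₂ x>0) (inj₂ y>0) x≈-y = contradiction (pos-resp x≈-y x>0) (pos-asym y>0)

    -- The value is chosen by `sign`, which is not known to respect `≈`. Uniqueness repairs this:
    -- congruence, evenness and multiplicativity of the absolute value all follow from it.
    ∣∣-unique : ∀ {x y} → NonNeg y → y ≈ x ⊎ y ≈ - x → ∣ x ∣ ≈ y
    ∣∣-unique {x} {y} y≥0 y≈±x with ∣∣-± x | y≈±x
    ... | inj₁ p | inj₁ q = trans p (sym q)
    ... | inj₂ p | inj₂ q = trans p (sym q)
    ... | inj₁ p | inj₂ q = nonNeg-antisym (∣∣-nonNeg x) y≥0
      (trans p (trans (sym (-‿involutive x)) (-‿cong (sym q))))
    ... | inj₂ p | inj₁ q = nonNeg-antisym (∣∣-nonNeg x) y≥0 (trans p (-‿cong (sym q)))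

    ∣∣-cong : ∀ {x y} → x ≈ y → ∣ x ∣ ≈ ∣ y ∣
    ∣∣-cong {x} {y} x≈y = ∣∣-unique (∣∣-nonNeg y) (Sum.map (λ p → trans p (sym x≈y)) (λ p → trans p (-‿cong (sym x≈y))) (∣∣-± y))

    ∣-x∣≈∣x∣ : ∀ x → ∣ - x ∣ ≈ ∣ x ∣
    ∣-x∣≈∣x∣ x with ∣∣-± x
    ... | inj₁ p = ∣∣-unique (∣∣-nonNeg x) (inj₂ (trans p (sym (-‿involutive x))))
    ... | inj₂ p = ∣∣-unique (∣∣-nonNeg x) (inj₁ p)

    ∣∣-* : ∀ x y → ∣ x * y ∣ ≈ ∣ x ∣ * ∣ y ∣
    ∣∣-* x y = ∣∣-unique (nonNeg-* (∣∣-nonNeg x) (∣∣-nonNeg y)) (signs (∣∣-± x) (∣∣-± y))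
      where
      signs : ∣ x ∣ ≈ x ⊎ ∣ x ∣ ≈ - x → ∣ y ∣ ≈ y ⊎ ∣ y ∣ ≈ - y →
              ∣ x ∣ * ∣ y ∣ ≈ x * y ⊎ ∣ x ∣ * ∣ y ∣ ≈ - (x * y)
      signs (inj₁ p) (inj₁ q) = inj₁ (*-cong p q)
      signs (inj₁ p) (inj₂ q) = inj₂ (trans (*-cong p q) (solve 2 (λ x y → x :* (:- y) := :- (x :* y)) refl x y))
      signs (inj₂ p) (inj₁ q) = inj₂ (trans (*-cong p q) (solve 2 (λ x y → (:- x) :* y := :- (x :* y)) refl x y))
      signs (inj₂ p) (inj₂ q) = inj₁ (trans (*-cong p q) (solve 2 (λ x y → (:- x) :* (:- y) := x :* y) refl x y))

    ∣∣-upper : ∀ x → NonNeg (∣ x ∣ - x)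
    ∣∣-upper x with ∣∣-± x
    ... | inj₁ p = inj₁ (trans (+-congʳ p) (-‿inverseʳ x))
    ... | inj₂ p = nonNeg-resp (+-congˡ p) (nonNeg-+ (∣∣-nonNeg x) (∣∣-nonNeg x))

    ∣∣-lower : ∀ x → NonNeg (∣ x ∣ + x)
    ∣∣-lower x = nonNeg-resp (+-cong (∣-x∣≈∣x∣ x) (-‿involutive x)) (∣∣-upper (- x))

    ∣y∣≤∣x∣+∣x-y∣ : ∀ x y → NonNeg (∣ x ∣ + ∣ x - y ∣ - ∣ y ∣)
    ∣y∣≤∣x∣+∣x-y∣ x y with ∣∣-± y
    ... | inj₁ p = nonNeg-resp
      (trans (solve 4 (λ X D x y → (X :- x) :+ (D :+ (x :- y)) := X :+ D :- y) refl (∣ x ∣) (∣ x - y ∣) x y)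
        (+-congˡ (-‿cong (sym p))))
      (nonNeg-+ (∣∣-upper x) (∣∣-lower (x - y)))
    ... | inj₂ p = nonNeg-resp
      (trans (solve 4 (λ X D x y → (X :+ x) :+ (D :- (x :- y)) := X :+ D :- (:- y)) refl (∣ x ∣) (∣ x - y ∣) x y)
        (+-congˡ (-‿cong (sym p))))
      (nonNeg-+ (∣∣-lower x) (∣∣-upper (x - y)))

    -- Trichotomy turns two refutations into a positive bound, so minimality, which is a negated
    -- inequality of reals, can be used for estimates.
    ∣∣-bound : ∀ {x y} → ¬ Pos (x - y) → ¬ Pos (- x - y) → NonNeg (y - ∣ x ∣)
    ∣∣-bound {x} {y} ¬x>y ¬-x>y = by-sign (sign (y - ∣ x ∣))
      where
      flip : ∀ {z} → ∣ x ∣ ≈ z → - (y - ∣ x ∣) ≈ z - y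
      flip eq = trans (solve 2 (λ y X → :- (y :- X) := X :- y) refl y ∣ x ∣) (+-congʳ eq)
      by-sign : y - ∣ x ∣ ≈ 0# ⊎ Pos (y - ∣ x ∣) ⊎ Pos (- (y - ∣ x ∣)) → NonNeg (y - ∣ x ∣)
      by-sign (inj₁ z) = inj₁ z
      by-sign (inj₂ (inj₁ z)) = inj₂ z
      by-sign (inj₂ (inj₂ z)) with ∣∣-± x
      ... | inj₁ p = contradiction (pos-resp (flip p) z) ¬x>y
      ... | inj₂ p = contradiction (pos-resp (flip p) z) ¬-x>y

    -- Lower bounds for |δ| across one step, with X = |x|, Y = |x̄|, D = |δ| and D′ = |δ| one step
    -- later.

    private
      2ℚ 3ℚ 4ℚ : ℚ
      2ℚ = 1ℚ ℚ.+ 1ℚ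
      3ℚ = 1ℚ ℚ.+ 2ℚ
      4ℚ = 2ℚ ℚ.+ 2ℚ

      nonNeg-ι : ∀ q .{{_ : ℚ.Positive q}} → NonNeg (ι q)
      nonNeg-ι q = inj₂ (pos-ι (ℚ.positive⁻¹ q))

    -- From D = D′XY < D′(1 + D): the bound D′ > D / (1 + D) is monotone in D ≥ s.
    gap-after-large-term : ∀ {X Y D D′ s} → D ≈ D′ * (X * Y) → NonNeg X → Pos (ι 1ℚ - X) →
      NonNeg (X + D - Y) → NonNeg D′ → Pos s → NonNeg (D - s) → Pos (D′ * (ι 1ℚ + s) - s)
    gap-after-large-term {X} {Y} {D} {D′} {s} D≈D′XY X≥0 X<1 Y≤X+D D′≥0 s>0 D≥s =
      -- After multiplication by D, every summand is a product of quantities with known sign, apart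
      -- from a multiple of D - D′XY. Strictness comes from sD(1 - X).
      pos-*-cancel D>0 (pos-certificate
        (solve 5 (λ X Y D D′ s →
            D :* (D′ :* (con 1ℚ :+ s) :- s)
            := (s :* D′ :* X :* (X :+ D :- Y)
               :+ D′ :* (((D :- s) :+ s :* ((con 1ℚ :- X) :* (con 1ℚ :+ X))) :+ s :* D :* (con 1ℚ :- X)))
               :+ (:- s) :* (D :- D′ :* (X :* Y))) refl X Y D D′ s)
        (trans (+-congʳ D≈D′XY) (-‿inverseʳ _))
        (nonNeg+pos⇒pos
          (nonNeg-* (nonNeg-* (nonNeg-* (inj₂ s>0) D′≥0) X≥0) Y≤X+D)
          (pos-* D′>0 (nonNeg+pos⇒pos
            (nonNeg-+ D≥s (nonNeg-* (inj₂ s>0) (nonNeg-* (inj₂ X<1) (nonNeg-+ (nonNeg-ι 1ℚ) X≥0))))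
            (pos-* (pos-* s>0 D>0) X<1)))))
      where
      D>0 : Pos D
      D>0 = pos-resp (solve 2 (λ D s → D :- s :+ s := D) refl D s) (nonNeg+pos⇒pos D≥s s>0)
      D′>0 : Pos D′
      D′>0 = pos-≉0 D′≥0 λ D′≈0 → pos⇒≉0 D>0 (trans D≈D′XY (trans (*-congʳ D′≈0) (zeroˡ _)))

    -- From D = D′XY ≤ D′(1 + 2D) / 4 and D > s / (1 + s), where s ≤ 1.
    gap-after-small-term : ∀ {X Y D D′ s} → D ≈ D′ * (X * Y) → NonNeg X → NonNeg (ι ½ - X) →
      NonNeg (X + D - Y) → NonNeg D → NonNeg D′ → NonNeg (ι 1ℚ - s) →
      Pos (D * (ι 1ℚ + s) - s) → Pos (D′ - s)
    gap-after-small-term {X} {Y} {D} {D′} {s} D≈D′XY X≥0 X≤½ Y≤X+D D≥0 D′≥0 s≤1 gap =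
      -- The bracket after D′ equals 1 + 2D - 4XY, and the multiplier -4 of the relation cancels its
      -- last term. Strictness comes from `gap`.
      pos-*-cancel 1+2D>0 (pos-certificate
        (solve 5 (λ X Y D D′ s →
            (con 2ℚ :* D :+ con 1ℚ) :* (D′ :- s)
            := (D′ :* (con 4ℚ :* (X :* (X :+ D :- Y))
                       :+ (con 2ℚ :* ((con ½ :- X) :* (con 1ℚ :+ con 2ℚ :* X)) :+ con 4ℚ :* (D :* (con ½ :- X))))
                :+ con 3ℚ :* (D :* (con 1ℚ :- s))
                :+ (D :* (con 1ℚ :+ s) :- s))
               :+ con (ℚ.- 4ℚ) :* (D :- D′ :* (X :* Y))) refl X Y D D′ s)
        (trans (+-congʳ D≈D′XY) (-‿inverseʳ _))
        (nonNeg+pos⇒pos (nonNeg-+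
          (nonNeg-* D′≥0 (nonNeg-+ (nonNeg-* (nonNeg-ι 4ℚ) (nonNeg-* X≥0 Y≤X+D)) (nonNeg-+
            (nonNeg-* (nonNeg-ι 2ℚ) (nonNeg-* X≤½ (nonNeg-+ (nonNeg-ι 1ℚ) (nonNeg-* (nonNeg-ι 2ℚ) X≥0))))
            (nonNeg-* (nonNeg-ι 4ℚ) (nonNeg-* D≥0 X≤½)))))
          (nonNeg-* (nonNeg-ι 3ℚ) (nonNeg-* D≥0 s≤1)))
          gap))
      where
      1+2D>0 : Pos (ι 2ℚ * D + ι 1ℚ)
      1+2D>0 = nonNeg+pos⇒pos (nonNeg-* (nonNeg-ι 2ℚ) D≥0) (pos-ι (ℚ.positive⁻¹ 1ℚ))

  -- The order induced by the real embedding.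

  module RealEmbedding
    (σ∞ : Carrier → ℝ) (σ∞-mono : IsRingMonomorphism rawRing ℝ-rawRing σ∞) where

    private
      module σ = IsRingMonomorphism σ∞-mono

    -- A record, so that x can be recovered by unification from the type Pos x.
    record Pos (x : Carrier) : Set where
      constructor mk
      field positive : Positiveℝ (σ∞ x)

    abstract
      pos-resp : ∀ {x y} → x ≈ y → Pos x → Pos y
      pos-resp {x} {y} x≈y (mk p) = mk (positive-resp-≈ {σ∞ x} {σ∞ y} (σ.⟦⟧-cong x≈y) p)

      pos-+ : ∀ {x y} → Pos x → Pos y → Pos (x + y)
      pos-+ {x} {y} (mk p) (mk q) = mk (positive-resp-≈ {σ∞ x +ℝ σ∞ y} {σ∞ (x + y)}
        (≈ℝ-sym {σ∞ (x + y)} {σ∞ x +ℝ σ∞ y} (σ.+-homo x y)) (positive-+ {σ∞ x} {σ∞ y} p q))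

      pos-* : ∀ {x y} → Pos x → Pos y → Pos (x * y)
      pos-* {x} {y} (mk p) (mk q) = mk (positive-resp-≈ {σ∞ x *ℝ σ∞ y} {σ∞ (x * y)}
        (≈ℝ-sym {σ∞ (x * y)} {σ∞ x *ℝ σ∞ y} (σ.*-homo x y)) (positive-* {σ∞ x} {σ∞ y} p q))

      pos-asym : ∀ {x} → Pos x → ¬ Pos (- x)
      pos-asym {x} (mk p) (mk q) = positive-asym {σ∞ x} p (positive-resp-≈ {σ∞ (- x)} { -ℝ σ∞ x} (σ.-‿homo x) q)

      σ∞-ι : ∀ q → σ∞ (ι q) ≈ℝ fromℚ q
      σ∞-ι = homo⇒fromℚ (λ q → σ∞ (ι q))
        (λ p q → ≈ℝ-trans {σ∞ (ι (p ℚ.+ q))} {σ∞ (ι p + ι q)} {σ∞ (ι p) +ℝ σ∞ (ι q)}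
          (σ.⟦⟧-cong (ι.+-homo p q)) (σ.+-homo (ι p) (ι q)))
        (≈ℝ-trans {σ∞ (ι 0ℚ)} {σ∞ 0#} {fromℚ 0ℚ} (σ.⟦⟧-cong ι.0#-homo) σ.0#-homo)
        (λ p → ≈ℝ-trans {σ∞ (ι (ℚ.- p))} {σ∞ (- ι p)} { -ℝ σ∞ (ι p)} (σ.⟦⟧-cong (ι.-‿homo p)) (σ.-‿homo (ι p)))
        (≈ℝ-trans {σ∞ (ι 1ℚ)} {σ∞ 1#} {fromℚ 1ℚ} (σ.⟦⟧-cong ι.1#-homo) σ.1#-homo)

      pos-ι : ∀ {q} → 0ℚ ℚ.< q → Pos (ι q)
      pos-ι {q} q>0 = mk (positive-resp-≈ {fromℚ q} {σ∞ (ι q)} (≈ℝ-sym {σ∞ (ι q)} {fromℚ q} (σ∞-ι q))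
        (q , q>0 , 0 , λ _ _ → ℚ.≤-refl))

      ≉0⇒sign : ∀ {x} → x ≉ 0# → Pos x ⊎ Pos (- x)
      ≉0⇒sign {x} x≉0 = Sum.map mk
        (λ p → mk (positive-resp-≈ { -ℝ σ∞ x} {σ∞ (- x)} (≈ℝ-sym {σ∞ (- x)} { -ℝ σ∞ x} (σ.-‿homo x)) p))
        (product⇒sign {σ∞ x} {σ∞ (x ⁻¹)} (ℚ.positive⁻¹ 1ℚ)
          (≈ℝ-trans {σ∞ x *ℝ σ∞ (x ⁻¹)} {σ∞ (x * x ⁻¹)} {fromℚ 1ℚ}
            (≈ℝ-sym {σ∞ (x * x ⁻¹)} {σ∞ x *ℝ σ∞ (x ⁻¹)} (σ.*-homo x (x ⁻¹)))
            (≈ℝ-trans {σ∞ (x * x ⁻¹)} {σ∞ 1#} {fromℚ 1ℚ} (σ.⟦⟧-cong (⁻¹-inverseʳ x x≉0)) σ.1#-homo)))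

      -- The coordinates with respect to 1 and θ are rational, so equality with 0 is decidable; a
      -- non-zero element gets its sign from its inverse.
      sign : ∀ x → x ≈ 0# ⊎ Pos x ⊎ Pos (- x)
      sign x with spanning x
      ... | p , q , x≈p+qθ with p ℚ.≟ 0ℚ | q ℚ.≟ 0ℚ
      ... | yes ≡.refl | yes ≡.refl = inj₁ (trans x≈p+qθ (trans
              (+-cong ι.0#-homo (trans (*-congʳ ι.0#-homo) (zeroˡ θ))) (+-identityˡ 0#)))
      ... | no p≢0 | _      = inj₂ (≉0⇒sign λ x≈0 → p≢0 (proj₁ (independent p q (trans (sym x≈p+qθ) x≈0))))
      ... | yes _  | no q≢0 = inj₂ (≉0⇒sign λ x≈0 → q≢0 (proj₂ (independent p q (trans (sym x≈p+qθ) x≈0))))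

    open OrderedField Pos pos-resp pos-+ pos-* pos-asym pos-ι sign public

    σ∞-neg : ∀ {x r} → σ∞ x ≈ℝ r → σ∞ (- x) ≈ℝ -ℝ r
    σ∞-neg {x} {r} p = ≈ℝ-trans {σ∞ (- x)} { -ℝ σ∞ x} { -ℝ r} (σ.-‿homo x) (-ℝ-cong {σ∞ x} {r} p)

    σ∞-sub : ∀ {x y r s} → σ∞ x ≈ℝ r → σ∞ y ≈ℝ s → σ∞ (x - y) ≈ℝ r -ℝ s
    σ∞-sub {x} {y} {r} {s} p q = ≈ℝ-trans {σ∞ (x - y)} {σ∞ x +ℝ σ∞ (- y)} {r -ℝ s} (σ.+-homo x (- y))
      (+ℝ-cong {σ∞ x} {r} {σ∞ (- y)} { -ℝ s} p (σ∞-neg {y} {s} q))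

    pos-sub⇒<ℝ : ∀ {x y r s} → σ∞ x ≈ℝ r → σ∞ y ≈ℝ s → Pos (y - x) → r <ℝ s
    pos-sub⇒<ℝ {x} {y} {r} {s} p q (mk x<y) =
      positive⇒<ℝ {r} {s} (positive-resp-≈ {σ∞ (y - x)} {s -ℝ r} (σ∞-sub {y} {x} {s} {r} q p) x<y)

    <ℝ⇒pos-sub : ∀ {x y r s} → σ∞ x ≈ℝ r → σ∞ y ≈ℝ s → r <ℝ s → Pos (y - x)
    <ℝ⇒pos-sub {x} {y} {r} {s} p q r<s = mk (positive-resp-≈ {s -ℝ r} {σ∞ (y - x)}
      (≈ℝ-sym {σ∞ (y - x)} {s -ℝ r} (σ∞-sub {y} {x} {s} {r} q p)) (<ℝ⇒positive {r} {s} r<s))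

  -- Valuation bounds induced by the 2-adic embedding.

  module DyadicEmbedding
    (σ₂ : Carrier → ℚ₂) (σ₂-mono : IsRingMonomorphism rawRing ℚ₂-rawRing σ₂) where

    private
      module σ = IsRingMonomorphism σ₂-mono

    record V (k : ℕ) (x : Carrier) : Set where
      constructor mk
      field val≥ : Val≥ k (σ₂ x)

    V-resp : ∀ {k x y} → x ≈ y → V k x → V k y
    V-resp {k} {x} {y} x≈y (mk p) = mk (Val≥-resp-≈ {k} {σ₂ x} {σ₂ y} (σ.⟦⟧-cong x≈y) p)

    V-+ : ∀ {k x y} → V k x → V k y → V k (x + y)
    V-+ {k} {x} {y} (mk p) (mk q) = mk (Val≥-resp-≈ {k} {σ₂ x +ℚ₂ σ₂ y} {σ₂ (x + y)}
      (≈ℚ₂-sym {σ₂ (x + y)} {σ₂ x +ℚ₂ σ₂ y} (σ.+-homo x y)) (Val≥-+ {k} {σ₂ x} {σ₂ y} p q))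

    V-neg : ∀ {k x} → V k x → V k (- x)
    V-neg {k} {x} (mk p) = mk (Val≥-resp-≈ {k} { -ℚ₂ σ₂ x} {σ₂ (- x)}
      (≈ℚ₂-sym {σ₂ (- x)} { -ℚ₂ σ₂ x} (σ.-‿homo x)) (Val≥-neg {k} {σ₂ x} p))

    V-sub : ∀ {k x y} → V k x → V k y → V k (x - y)
    V-sub p q = V-+ p (V-neg q)

    V-* : ∀ {k l x y} → V k x → V l y → V (k ℕ.+ l) (x * y)
    V-* {k} {l} {x} {y} (mk p) (mk q) = mk (Val≥-resp-≈ {k ℕ.+ l} {σ₂ x *ℚ₂ σ₂ y} {σ₂ (x * y)}
      (≈ℚ₂-sym {σ₂ (x * y)} {σ₂ x *ℚ₂ σ₂ y} (σ.*-homo x y)) (Val≥-* {k} {l} {σ₂ x} {σ₂ y} p q))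

    V-weaken : ∀ {k x} → V (suc k) x → V k x
    V-weaken {k} {x} (mk p) = mk (Val≥-weaken {k} {σ₂ x} p)

    V-double : ∀ {k x} → V k x → V (suc k) (x + x)
    V-double {k} {x} (mk p) = mk (Val≥-resp-≈ {suc k} {σ₂ x +ℚ₂ σ₂ x} {σ₂ (x + x)}
      (≈ℚ₂-sym {σ₂ (x + x)} {σ₂ x +ℚ₂ σ₂ x} (σ.+-homo x x)) (Val≥-double {k} {σ₂ x} p))

    V0-1# : V 0 1#
    V0-1# = mk (Val≥-resp-≈ {0} {1ℚ₂} {σ₂ 1#} (≈ℚ₂-sym {σ₂ 1#} {1ℚ₂} σ.1#-homo) Val≥0-1)

    ¬V1-1# : ¬ V 1 1#
    ¬V1-1# (mk p) = ¬Val≥1-1 (Val≥-resp-≈ {1} {σ₂ 1#} {1ℚ₂} σ.1#-homo p)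

    -- Stands in for v(y) = -v(x), without computing either valuation.
    V-split : ∀ {x y} → x * y ≈ 1# → V 0 x ⊎ V 1 y
    V-split {x} {y} xy≈1 = Sum.map mk mk (Val≥-*-split {σ₂ x} {σ₂ y}
      (Val≥-resp-≈ {0} {σ₂ (x * y)} {σ₂ x *ℚ₂ σ₂ y} (σ.*-homo x y) (V.val≥ (V-resp (sym xy≈1) V0-1#))))

    ι-suc/1 : ∀ n → ι (+ suc n ℚ./ 1) ≈ 1# + ι (+ n ℚ./ 1)
    ι-suc/1 n = trans (ι.⟦⟧-cong (/1-homo-+ (+ 1) (+ n))) (trans (ι.+-homo 1ℚ _) (+-congʳ ι.1#-homo))

    V0-ℕ : ∀ n → V 0 (ι (+ n ℚ./ 1))
    V0-ℕ zero    = V-resp (trans (-‿inverseʳ 1#) (sym ι.0#-homo)) (V-sub V0-1# V0-1#)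
    V0-ℕ (suc n) = V-resp (sym (ι-suc/1 n)) (V-+ V0-1# (V0-ℕ n))

    V0-ℤ : ∀ i → V 0 (ι (i ℚ./ 1))
    V0-ℤ (+ n)    = V0-ℕ n
    V0-ℤ -[1+ n ] = V-resp (sym (ι.-‿homo _)) (V-neg (V0-ℕ (suc n)))

    V1-2ℤ : ∀ i → V 1 (ι ((+ 2 ℤ.* i) ℚ./ 1))
    V1-2ℤ i = V-resp (sym (trans (ι.⟦⟧-cong (≡.trans (≡.cong (ℚ._/ 1) 2i≡i+i) (/1-homo-+ i i))) (ι.+-homo _ _)))
      (V-double (V0-ℤ i))
      where
      2i≡i+i : + 2 ℤ.* i ≡ i ℤ.+ i
      2i≡i+i = ≡.trans (ℤ.*-distribʳ-+ i (+ 1) (+ 1)) (≡.cong₂ ℤ._+_ (ℤ.*-identityˡ i) (ℤ.*-identityˡ i))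

    -- Values of `σ₂` on integer multiples are found by counting up from 0, which uses only
    -- additivity; this is how denominators 2ᵉ are cleared.
    σ₂-scale : ∀ n x → σ₂ (ι (+ n ℚ./ 1) * x) ≈ℚ₂ n · σ₂ x
    σ₂-scale zero    x = ≈ℚ₂-trans {σ₂ (ι 0ℚ * x)} {σ₂ 0#} {0 · σ₂ x}
      (σ.⟦⟧-cong (trans (*-congʳ ι.0#-homo) (zeroˡ x)))
      (≈ℚ₂-trans {σ₂ 0#} {0ℚ₂} {0 · σ₂ x} σ.0#-homo (0·-≈ (σ₂ x)))
    σ₂-scale (suc n) x = ≈ℚ₂-trans {σ₂ (ι (+ suc n ℚ./ 1) * x)} {σ₂ (x + y)} {suc n · σ₂ x}
      (σ.⟦⟧-cong (trans (*-congʳ (ι-suc/1 n)) (trans (distribʳ x 1# (ι (+ n ℚ./ 1))) (+-congʳ (*-identityˡ x)))))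
      (≈ℚ₂-trans {σ₂ (x + y)} {σ₂ x +ℚ₂ σ₂ y} {suc n · σ₂ x} (σ.+-homo x y)
        (≈ℚ₂-trans {σ₂ x +ℚ₂ σ₂ y} {σ₂ x +ℚ₂ n · σ₂ x} {suc n · σ₂ x}
          (+ℚ₂-cong {σ₂ x} {σ₂ x} {σ₂ y} {n · σ₂ x} (≈ℚ₂-refl {σ₂ x}) (σ₂-scale n x))
          (suc·-≈ n (σ₂ x))))
      where y = ι (+ n ℚ./ 1) * x

    -- With ⌊σ₂ x⌋₂ = D / 2ᵉ, the claim is read off 2ᵉ x - D.
    V1-sub-⌊⌋₂ : ∀ x → V 1 (x - ι ⌊ σ₂ x ⌋₂)
    V1-sub-⌊⌋₂ x = mk (Val≥-2^· e 1 (σ₂ z)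
      (Val≥-resp-≈ {e ℕ.+ 1} {(t /2^ 0) +ℚ₂ -ℚ₂ (D · 1ℚ₂)} {(2 ℕ.^ e) · σ₂ z}
        (≈ℚ₂-sym {(2 ℕ.^ e) · σ₂ z} {(t /2^ 0) +ℚ₂ -ℚ₂ (D · 1ℚ₂)} approx)
        (Val≥-sub-digitSum t e)))
      where
      open ℚ₂ (σ₂ x) renaming (numerator to t; exponent to e)
      instance _ = ℕ.m^n≢0 2 e
      D = digitSum t (suc e)
      q = ⌊ σ₂ x ⌋₂
      z = x - ι q
      N = ι (+ (2 ℕ.^ e) ℚ./ 1)
      N*z : N * z ≈ N * x - ι (+ D ℚ./ 1) * 1#
      N*z = trans (solve 3 (λ N x q → N :* (x :- q) := N :* x :- q :* N) refl N x (ι q))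
        (+-congˡ (-‿cong (trans (trans (sym (ι.*-homo q _))
          (ι.⟦⟧-cong (/-*-cancel (+ D) (2 ℕ.^ e)))) (sym (*-identityʳ _)))))
      D1 = ι (+ D ℚ./ 1) * 1#
      approx : (2 ℕ.^ e) · σ₂ z ≈ℚ₂ (t /2^ 0) +ℚ₂ -ℚ₂ (D · 1ℚ₂)
      approx =
        ≈ℚ₂-trans {(2 ℕ.^ e) · σ₂ z} {σ₂ (N * z)} {(t /2^ 0) +ℚ₂ -ℚ₂ (D · 1ℚ₂)}
          (≈ℚ₂-sym {σ₂ (N * z)} {(2 ℕ.^ e) · σ₂ z} (σ₂-scale (2 ℕ.^ e) z))
        (≈ℚ₂-trans {σ₂ (N * z)} {σ₂ (N * x - D1)} {(t /2^ 0) +ℚ₂ -ℚ₂ (D · 1ℚ₂)} (σ.⟦⟧-cong N*z)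
        (≈ℚ₂-trans {σ₂ (N * x - D1)} {σ₂ (N * x) +ℚ₂ σ₂ (- D1)} {(t /2^ 0) +ℚ₂ -ℚ₂ (D · 1ℚ₂)} (σ.+-homo (N * x) (- D1))
        (+ℚ₂-cong {σ₂ (N * x)} {t /2^ 0} {σ₂ (- D1)} { -ℚ₂ (D · 1ℚ₂)}
          (≈ℚ₂-trans {σ₂ (N * x)} {(2 ℕ.^ e) · σ₂ x} {t /2^ 0} (σ₂-scale (2 ℕ.^ e) x) (2^·-cancel t e))
          (≈ℚ₂-trans {σ₂ (- D1)} { -ℚ₂ σ₂ D1} { -ℚ₂ (D · 1ℚ₂)} (σ.-‿homo D1)
            (-ℚ₂-cong {σ₂ D1} {D · 1ℚ₂}
              (≈ℚ₂-trans {σ₂ D1} {D · σ₂ 1#} {D · 1ℚ₂} (σ₂-scale D 1#) (·-cong D {σ₂ 1#} {1ℚ₂} σ.1#-homo)))))))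

  -- Conjugation and the differences δ.

  module Conjugation
    (conj : Op₁ Carrier) (isConj : IsGaloisConjugation conj) where

    open IsGaloisConjugation isConj public using (fixesℚ; nontrivial)
    module conj = IsRingIsomorphism (IsGaloisConjugation.isRingIsomorphism isConj)

    -- An irrational x = p + qθ has q ≠ 0. If x were fixed, so would be θ, and then the whole field.
    irrational⇒conj≉ : ∀ {x} → Irrational x → conj x ≉ x
    irrational⇒conj≉ {x} irrational x̄≈x with spanning x
    ... | p , q , x≈p+qθ = nontrivial λ y → let (r , s , y≈r+sθ) = spanning y in
      trans (conj-linear y≈r+sθ) (trans (+-congˡ (*-congˡ θ̄≈θ)) (sym y≈r+sθ))
      where
      conj-linear : ∀ {y r s} → y ≈ ι r + ι s * θ → conj y ≈ ι r + ι s * conj θ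
      conj-linear {y} {r} {s} eq = trans (conj.⟦⟧-cong eq) (trans (conj.+-homo (ι r) (ι s * θ))
        (+-cong (fixesℚ r) (trans (conj.*-homo (ι s) θ) (*-congʳ (fixesℚ s)))))
      q≉0 : ι q ≉ 0#
      q≉0 ιq≈0 = irrational p (trans x≈p+qθ (trans (+-congˡ (trans (*-congʳ ιq≈0) (zeroˡ θ))) (+-identityʳ (ι p))))
      θ̄≈θ : conj θ ≈ θ
      θ̄≈θ = x-y≈0⇒x≈y (*-cancel-≈0 q≉0 (trans
        (solve 4 (λ p q t t′ → q :* (t′ :- t) := (p :+ q :* t′) :- (p :+ q :* t)) refl (ι p) (ι q) θ (conj θ))
        (trans (+-cong (trans (sym (conj-linear x≈p+qθ)) x̄≈x) (-‿cong (sym x≈p+qθ))) (-‿inverseʳ x))))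

    conj-fixed-± : ∀ {x q} → x ≈ ι q ⊎ - x ≈ ι q → conj x ≈ x
    conj-fixed-± {x} {q} (inj₁ x≈q) = trans (conj.⟦⟧-cong x≈q) (trans (fixesℚ q) (sym x≈q))
    conj-fixed-± {x} {q} (inj₂ -x≈q) = begin
      conj x          ≈⟨ conj.⟦⟧-cong (solve 1 (λ x → x := :- :- x) refl x) ⟩
      conj (- (- x))  ≈⟨ conj.-‿homo (- x) ⟩
      - conj (- x)    ≈⟨ -‿cong (conj-fixed-± (inj₁ -x≈q)) ⟩
      - (- x)         ≈⟨ solve 1 (λ x → :- :- x := x) refl x ⟩
      x               ∎
      where open SetoidReasoning setoid

    -- One step x ↦ x⁻¹ - a of the algorithm, together with its conjugate.
    record Step (x x⁺ : Carrier) : Set (c ⊔ ℓ) where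
      field
        a x⁻ y⁻  : Carrier
        x-inv    : x * x⁻ ≈ 1#
        y-inv    : conj x * y⁻ ≈ 1#
        x-next   : x⁺ ≈ x⁻ - a
        y-next   : conj x⁺ ≈ y⁻ - a

    δ : Carrier → Carrier
    δ x = x - conj x

    δ-cong : ∀ {x y} → x ≈ y → δ x ≈ δ y
    δ-cong x≈y = +-cong x≈y (-‿cong (conj.⟦⟧-cong x≈y))

    -- The partial quotient is rational, so it is the same for x and its conjugate and cancels in
    -- `δ x⁺`, leaving 1/x - 1/x̄.
    δ-step : ∀ {x x⁺} → Step x x⁺ → δ x ≈ δ x⁺ * - (x * conj x)
    δ-step {x} {x⁺} st = begin
      x - y                            ≈⟨ +-cong (*-identityʳ x) (-‿cong (*-identityʳ y)) ⟨
      x * 1# - y * 1#                  ≈⟨ +-cong (*-congˡ y-inv) (-‿cong (*-congˡ x-inv)) ⟨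
      x * (y * y⁻) - y * (x * x⁻)      ≈⟨ solve 5 (λ x y x′ y′ a →
                                            x :* (y :* y′) :- y :* (x :* x′) := ((x′ :- a) :- (y′ :- a)) :* (:- (x :* y)))
                                            refl x y x⁻ y⁻ a ⟩
      ((x⁻ - a) - (y⁻ - a)) * - (x * y) ≈⟨ *-congʳ (+-cong x-next (-‿cong y-next)) ⟨
      δ x⁺ * - (x * y)                 ∎
      where
      open SetoidReasoning setoid
      open Step st
      y = conj x

    inverse-step : ∀ {x x⁺ a} → x ≉ 0# → x⁺ ≈ x ⁻¹ - ι a → Step x x⁺
    inverse-step {x} {x⁺} {a} x≉0 x⁺≈ = record
      { a = ι a ; x⁻ = x ⁻¹ ; y⁻ = conj (x ⁻¹)
      ; x-inv = ⁻¹-inverseʳ x x≉0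
      ; y-inv = trans (sym (conj.*-homo x (x ⁻¹))) (trans (conj.⟦⟧-cong (⁻¹-inverseʳ x x≉0)) conj.1#-homo)
      ; x-next = x⁺≈
      ; y-next = trans (conj.⟦⟧-cong x⁺≈) (trans (conj.+-homo (x ⁻¹) (- ι a))
          (+-congˡ (trans (conj.-‿homo (ι a)) (-‿cong (fixesℚ a)))))
      }

  -- Real and 2-adic bounds after one step of the algorithm.

  module Dynamics
    (σ∞ : Carrier → ℝ) (σ∞-mono : IsRingMonomorphism rawRing ℝ-rawRing σ∞)
    (σ₂ : Carrier → ℚ₂) (σ₂-mono : IsRingMonomorphism rawRing ℚ₂-rawRing σ₂)
    (conj : Op₁ Carrier) (isConj : IsGaloisConjugation conj) where

    open RealEmbedding σ∞ σ∞-mono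
    open DyadicEmbedding σ₂ σ₂-mono
    open Conjugation conj isConj
    open Algorithm K σ∞ σ₂

    halfSpacing : Fin 2 → ℚ
    halfSpacing 0F = 1ℚ
    halfSpacing 1F = ½

    halfSpacing>0 : ∀ ε → 0ℚ ℚ.< halfSpacing ε
    halfSpacing>0 0F = ℚ.positive⁻¹ 1ℚ
    halfSpacing>0 1F = ℚ.positive⁻¹ ½

    candidate-suc : ∀ ε x i → candidate ε x (ℤ.suc i) ≡ candidate ε x i ℚ.+ (halfSpacing ε ℚ.+ halfSpacing ε)
    candidate-suc ε x i = ≡.trans
      (≡.cong (ℚ._+ ⌊ σ₂ (x ⁻¹) ⌋₂) (≡.trans
        (≡.cong (ℚ._/ 1) (≡.trans (ℤ.*-distribˡ-+ (spacing ε) (+ 1) i)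
          (≡.cong (ℤ._+ spacing ε ℤ.* i) (ℤ.*-identityʳ (spacing ε)))))
        (≡.trans (/1-homo-+ (spacing ε) (spacing ε ℤ.* i)) (≡.cong (ℚ._+ (spacing ε ℤ.* i) ℚ./ 1) (double ε)))))
      (ℚS.solve 3 (λ h s f → h ℚS.:+ h ℚS.:+ s ℚS.:+ f ℚS.:= s ℚS.:+ f ℚS.:+ (h ℚS.:+ h)) ≡.refl
        (halfSpacing ε) ((spacing ε ℤ.* i) ℚ./ 1) ⌊ σ₂ (x ⁻¹) ⌋₂)
      where
      double : ∀ ε → spacing ε ℚ./ 1 ≡ halfSpacing ε ℚ.+ halfSpacing ε
      double 0F = ≡.refl
      double 1F = ≡.refl

    <+positive : ∀ p {q} → 0ℚ ℚ.< q → p ℚ.< p ℚ.+ (q ℚ.+ q)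
    <+positive p {q} q>0 = ≡.subst (ℚ._< p ℚ.+ (q ℚ.+ q)) (ℚ.+-identityʳ p) (ℚ.+-monoʳ-< p (ℚ.+-mono-< q>0 q>0))

    -- Consecutive candidates are 2h apart. If x⁺ exceeded h, then 1/x would lie beyond the midpoint
    -- a + h and the next candidate would be strictly closer; below -h the previous one would be.
    T₂-bounded : ∀ {ε x x⁺} → T₂ ε x x⁺ → NonNeg (ι (halfSpacing ε) - ∣ x⁺ ∣)
    T₂-bounded {ε} {x} {x⁺} (a , (x≉0 , m , (minimal , _) , ≡.refl) , x⁺≈) = ∣∣-bound not-above not-below
      where
      h = halfSpacing ε
      r = σ∞ (x ⁻¹)
      r≈ = ≈ℝ-refl r
      not-above : ¬ Pos (x⁺ - ι h)
      not-above x⁺>h = minimal (ℤ.suc m)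
        (closer-above {r} {a} {candidate ε x (ℤ.suc m)} {a ℚ.+ h}
          (≡.subst (a ℚ.<_) (≡.sym (candidate-suc ε x m)) (<+positive a (halfSpacing>0 ε)))
          (≡.trans (ℚS.solve 2 (λ a h → (a ℚS.:+ h) ℚS.:+ (a ℚS.:+ h) ℚS.:= a ℚS.:+ (a ℚS.:+ (h ℚS.:+ h))) ≡.refl a h)
            (≡.cong (a ℚ.+_) (≡.sym (candidate-suc ε x m))))
          (pos-sub⇒<ℝ {ι (a ℚ.+ h)} {x ⁻¹} {fromℚ (a ℚ.+ h)} {r} (σ∞-ι (a ℚ.+ h)) r≈
            (pos-resp (trans (+-congʳ x⁺≈) (trans
              (solve 3 (λ x a h → x :- a :- h := x :- (a :+ h)) refl (x ⁻¹) (ι a) (ι h))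
              (+-congˡ (-‿cong (sym (ι.+-homo a h)))))) x⁺>h)))
      c′ = candidate ε x (ℤ.pred m)
      a≡ : a ≡ c′ ℚ.+ (h ℚ.+ h)
      a≡ = ≡.trans (≡.cong (candidate ε x) (≡.sym (ℤ.suc-pred m))) (candidate-suc ε x (ℤ.pred m))
      not-below : ¬ Pos (- x⁺ - ι h)
      not-below x⁺<-h = minimal (ℤ.pred m)
        (closer-below {r} {a} {c′} {a ℚ.- h}
          (≡.subst (c′ ℚ.<_) (≡.sym a≡) (<+positive c′ (halfSpacing>0 ε)))
          (≡.trans (ℚS.solve 2 (λ a h → (a ℚS.:- h) ℚS.:+ (a ℚS.:- h) ℚS.:= a ℚS.:+ (a ℚS.:- (h ℚS.:+ h))) ≡.refl a h)
            (≡.cong (a ℚ.+_) (≡.trans (≡.cong (ℚ._- (h ℚ.+ h)) a≡)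
              (ℚS.solve 2 (λ a h → a ℚS.:+ h ℚS.:- h ℚS.:= a) ≡.refl c′ (h ℚ.+ h)))))
          (pos-sub⇒<ℝ {x ⁻¹} {ι (a ℚ.- h)} {r} {fromℚ (a ℚ.- h)} r≈ (σ∞-ι (a ℚ.- h))
            (pos-resp (trans (+-congʳ (-‿cong x⁺≈)) (trans
              (solve 3 (λ x a h → :- (x :- a) :- h := (a :- h) :- x) refl (x ⁻¹) (ι a) (ι h))
              (+-congʳ (sym (trans (ι.+-homo a (ℚ.- h)) (+-congˡ (ι.-‿homo h))))))) x⁺<-h)))

    -- After removal of the 2-adic integral part of 1/x, only a multiple of the spacing is
    -- subtracted: even multiples preserve valuation at least 1, arbitrary ones only integrality.
    T₂-residue : ∀ {ε x x⁺} k → (∀ i → V k (ι ((spacing ε ℤ.* i) ℚ./ 1))) →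
                 V k (x ⁻¹ - ι ⌊ σ₂ (x ⁻¹) ⌋₂) → T₂ ε x x⁺ → V k x⁺
    T₂-residue {ε} {x} {x⁺} k V-spacing V-frac (a , (_ , m , _ , ≡.refl) , x⁺≈) =
      V-resp (sym (trans x⁺≈ (trans (+-congˡ (-‿cong (ι.+-homo s f)))
          (solve 3 (λ x s f → x :- (s :+ f) := (x :- f) :- s) refl (x ⁻¹) (ι s) (ι f)))))
        (V-sub V-frac (V-spacing m))
      where
      s = (spacing ε ℤ.* m) ℚ./ 1
      f = ⌊ σ₂ (x ⁻¹) ⌋₂

    T₂-even⇒V1 : ∀ {x x⁺} → T₂ 0F x x⁺ → V 1 x⁺
    T₂-even⇒V1 {x} {x⁺} = T₂-residue {0F} {x} {x⁺} 1 V1-2ℤ (V1-sub-⌊⌋₂ (x ⁻¹))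

    T₂-odd⇒V0 : ∀ {x x⁺} → T₂ 1F x x⁺ → V 0 x⁺
    T₂-odd⇒V0 {x} {x⁺} = T₂-residue {1F} {x} {x⁺} 0 (λ i → V0-ℤ (+ 1 ℤ.* i))
      (V-weaken (V1-sub-⌊⌋₂ (x ⁻¹)))

    T₂⇒Step : ∀ {ε x x⁺} → T₂ ε x x⁺ → Step x x⁺
    T₂⇒Step (a , (x≉0 , _) , x⁺≈) = inverse-step x≉0 x⁺≈

    -- Valuations of the conjugates, propagated backwards.

    ¬V1-inverse : ∀ {k l x y} → k ℕ.+ l ≡ 1 → V k x → V l y → ¬ x * y ≈ 1#
    ¬V1-inverse {k} {l} {x} {y} eq p q xy≈1 =
      ¬V1-1# (V-resp xy≈1 (≡.subst (λ n → V n (x * y)) eq (V-* p q)))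

    -- The partial quotient may itself fail to be 2-integral. It is eliminated through the
    -- conjugate: 1/x = x⁺ + (1/x̄ - x̄⁺), where x̄⁺ is the conjugate of x⁺.
    step-x⁻ : ∀ {k x x⁺} (st : Step x x⁺) → V k x⁺ → V k (conj x⁺) → V k (Step.y⁻ st) → V k (Step.x⁻ st)
    step-x⁻ {k} {x} {x⁺} st p q r = V-resp eq
      (V-+ p (V-sub r q))
      where
      open Step st
      eq : x⁺ + (y⁻ - conj x⁺) ≈ x⁻
      eq = trans (+-cong x-next (+-congˡ (-‿cong y-next)))
        (solve 3 (λ x y a → (x :- a) :+ (y :- (y :- a)) := x) refl x⁻ y⁻ a)

    -- Otherwise 1/x̄ is integral, hence so is 1/x by `step-x⁻`, which is impossible for an x of
    -- positive valuation.
    conj-backward-odd : ∀ {x x⁺} → Step x x⁺ → V 1 x → V 0 x⁺ → V 0 (conj x⁺) → V 1 (conj x)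
    conj-backward-odd {x} st p q r = Sum.[ (λ V0y⁻ → contradiction (Step.x-inv st)
        (¬V1-inverse ≡.refl p (step-x⁻ st q r V0y⁻))) , id ]
      (V-split (trans (*-comm (Step.y⁻ st) (conj x)) (Step.y-inv st)))

    -- Otherwise 1/x̄ has positive valuation, hence so has 1/x, which is impossible for an integral
    -- x.
    conj-backward-even : ∀ {x x⁺} → Step x x⁺ → V 0 x → V 1 x⁺ → V 1 (conj x⁺) → V 0 (conj x)
    conj-backward-even {x} st p q r = Sum.[ id , (λ V1y⁻ → contradiction (Step.x-inv st)
        (¬V1-inverse ≡.refl p (step-x⁻ st q r V1y⁻))) ]
      (V-split (Step.y-inv st))

    -- The two steps of the algorithm that start at an odd index.
    record DoubleStep (x x⁺⁺ : Carrier) : Set (c ⊔ ℓ) where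
      field
        {x⁺}    : Carrier
        step₁   : Step x x⁺
        step₂   : Step x⁺ x⁺⁺
        V0-x⁺   : V 0 x⁺
        V1-x⁺⁺  : V 1 x⁺⁺
        x⁺≤½    : NonNeg (ι ½ - ∣ x⁺ ∣)
        x⁺⁺≤1   : NonNeg (ι 1ℚ - ∣ x⁺⁺ ∣)

    T₂⇒DoubleStep : ∀ {x x⁺ x⁺⁺} → T₂ 1F x x⁺ → T₂ 0F x⁺ x⁺⁺ → DoubleStep x x⁺⁺
    T₂⇒DoubleStep {x} {x⁺} {x⁺⁺} T T′ = record
      { step₁  = T₂⇒Step {1F} {x} {x⁺} T
      ; step₂  = T₂⇒Step {0F} {x⁺} {x⁺⁺} T′
      ; V0-x⁺  = T₂-odd⇒V0 {x} {x⁺} T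
      ; V1-x⁺⁺ = T₂-even⇒V1 {x⁺} {x⁺⁺} T′
      ; x⁺≤½   = T₂-bounded {1F} {x} {x⁺} T
      ; x⁺⁺≤1  = T₂-bounded {0F} {x⁺} {x⁺⁺} T′
      }

    conj-contraction : ∀ {x x⁺⁺} → DoubleStep x x⁺⁺ → V 1 x → V 1 (conj x⁺⁺) →
                       V 1 (conj x) × ∃ λ p → V 1 p × δ x ≈ δ x⁺⁺ * p
    conj-contraction {x} {x⁺⁺} ds V1x V1y⁺⁺ = V1y , p , V1p , trans (δ-step step₁)
        (trans (*-congʳ (δ-step step₂)) (*-assoc (δ x⁺⁺) (- (x⁺ * conj x⁺)) (- (x * conj x))))
      where
      open DoubleStep ds
      V0y⁺ = conj-backward-even step₂ V0-x⁺ V1-x⁺⁺ V1y⁺⁺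
      V1y = conj-backward-odd step₁ V1x V0-x⁺ V0y⁺
      p = - (x⁺ * conj x⁺) * - (x * conj x)
      -- The bounds add up as (0 + 0) + (1 + 0); `conj x` is weakened to integrality to make the
      -- index exactly 1.
      V1p : V 1 p
      V1p = V-*
        (V-neg (V-* V0-x⁺ V0y⁺))
        (V-neg (V-* V1x (V-weaken V1y)))

    -- Growth of |δ| over two steps.

    ∣δ∣-step : ∀ {x x⁺} → Step x x⁺ → ∣ δ x ∣ ≈ ∣ δ x⁺ ∣ * (∣ x ∣ * ∣ conj x ∣)
    ∣δ∣-step {x} {x⁺} st = trans (∣∣-cong (δ-step st)) (trans (∣∣-* (δ x⁺) _)
      (*-congˡ (trans (∣-x∣≈∣x∣ (x * conj x)) (∣∣-* x (conj x)))))

    -- If |x| were 1, x would be 1 or -1, hence fixed by conjugation.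
    δ≉0⇒∣∣<1 : ∀ {x} → NonNeg (ι 1ℚ - ∣ x ∣) → δ x ≉ 0# → Pos (ι 1ℚ - ∣ x ∣)
    δ≉0⇒∣∣<1 {x} ≤1 δ≉0 = pos-≉0 ≤1 λ ∣x∣≈1 → δ≉0 (trans (+-congˡ (-‿cong (conj-fixed-± (Sum.map
      (λ p → trans (sym p) (sym (x-y≈0⇒x≈y ∣x∣≈1))) (λ p → trans (sym p) (sym (x-y≈0⇒x≈y ∣x∣≈1))) (∣∣-± x)))))
      (-‿inverseʳ x))

    -- The threshold `s` is kept apart from `∣ δ x ∣` so that the same value, |δ| at the start of
    -- the period, can serve at every later double step.
    δ-expansion : ∀ {x x⁺⁺ s} → DoubleStep x x⁺⁺ → NonNeg (ι 1ℚ - ∣ x ∣) → Pos s → NonNeg (ι 1ℚ - s) →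
                  NonNeg (∣ δ x ∣ - s) → Pos (∣ δ x⁺⁺ ∣ - s)
    δ-expansion {x} {x⁺⁺} {s} ds x≤1 s>0 s≤1 δ≥s =
      gap-after-small-term (∣δ∣-step step₂) (∣∣-nonNeg x⁺) x⁺≤½ (∣y∣≤∣x∣+∣x-y∣ x⁺ (conj x⁺))
        (∣∣-nonNeg (δ x⁺)) (∣∣-nonNeg (δ x⁺⁺)) s≤1
        (gap-after-large-term (∣δ∣-step step₁) (∣∣-nonNeg x) (δ≉0⇒∣∣<1 x≤1 δ≉0) (∣y∣≤∣x∣+∣x-y∣ x (conj x))
          (∣∣-nonNeg (δ x⁺)) s>0 δ≥s)
      where
      open DoubleStep ds
      δ>0 : Pos ∣ δ x ∣
      δ>0 = pos-resp (solve 2 (λ d s → (d :- s) :+ s := d) refl ∣ δ x ∣ s) (nonNeg+pos⇒pos δ≥s s>0)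
      δ≉0 : δ x ≉ 0#
      δ≉0 δ≈0 = ¬pos-0 (trans (∣∣-cong δ≈0) (∣∣-unique (inj₁ refl) (inj₁ refl))) δ>0

    -- One full period of k + 1 double steps.

    module Periodic (x : ℕ → Carrier) (double : ∀ j → DoubleStep (x j) (x (suc j)))
      (V1-x₀ : V 1 (x 0)) (x₀≤1 : NonNeg (ι 1ℚ - ∣ x 0 ∣)) (δ≉0 : δ (x 0) ≉ 0#)
      (k : ℕ) (x₀≈ : x 0 ≈ x (suc k)) where

      V1-x : ∀ j → V 1 (x j)
      V1-x zero    = V1-x₀
      V1-x (suc j) = DoubleStep.V1-x⁺⁺ (double j)

      x≤1 : ∀ j → NonNeg (ι 1ℚ - ∣ x j ∣)
      x≤1 zero    = x₀≤1
      x≤1 (suc j) = DoubleStep.x⁺⁺≤1 (double j)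

      -- The accumulated factor is only claimed to be integral, since for `i = 0` it is 1.
      backward : ∀ i j → V 1 (conj (x (i ℕ.+ j))) →
                 V 1 (conj (x j)) × ∃ λ p → V 0 p × δ (x j) ≈ δ (x (i ℕ.+ j)) * p
      backward zero    j V1y = V1y , 1# , V0-1# , sym (*-identityʳ (δ (x j)))
      backward (suc i) j V1y =
        let V1y′ , p , V1p , eq = conj-contraction (double (i ℕ.+ j)) (V1-x (i ℕ.+ j)) V1y
            V1y″ , q , V0q , eq′ = backward i j V1y′
        in V1y″ , p * q , V-* (V-weaken V1p) V0q ,
           trans eq′ (trans (*-congʳ eq) (*-assoc (δ (x (suc i ℕ.+ j))) p q))

      ¬V1-conj : ¬ V 1 (conj (x 0))
      ¬V1-conj V1y =
        -- The last k double steps of the period give an integral factor q; the first one, treated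
        -- separately, gives the factor p of positive valuation. Cancelling `δ (x 0)` then makes qp
        -- equal to 1.
        let V1y′ , q , V0q , eq′ = backward k 1 (V-resp x₀-conj V1y)
            _ , p , V1p , eq = conj-contraction (double 0) V1-x₀ V1y′
            δ≈ = trans eq (trans (*-congʳ eq′) (*-congʳ (*-congʳ x₀-δ)))
        in ¬V1-1# (V-resp (x-y≈0⇒x≈y (*-cancel-≈0 δ≉0 (product-trivial δ≈))) (V-* V0q V1p))
        where
        x₀-conj : conj (x 0) ≈ conj (x (k ℕ.+ 1))
        x₀-conj = trans (conj.⟦⟧-cong x₀≈) (reflexive (≡.cong (λ n → conj (x n)) (ℕ.+-comm 1 k)))
        x₀-δ : δ (x (k ℕ.+ 1)) ≈ δ (x 0)
        x₀-δ = trans (reflexive (≡.cong (λ n → δ (x n)) (ℕ.+-comm k 1))) (sym (δ-cong x₀≈))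
        product-trivial : ∀ {d p q} → d ≈ d * q * p → d * (q * p - 1#) ≈ 0#
        product-trivial {d} {p} {q} eq = trans (distribˡ d (q * p) (- 1#)) (trans
          (+-cong (trans (sym (*-assoc d q p)) (sym eq))
            (trans (sym (-‿distribʳ-* d 1#)) (-‿cong (*-identityʳ d))))
          (-‿inverseʳ d))

      ∣δ∣>0 : Pos ∣ δ (x 0) ∣
      ∣δ∣>0 = pos-≉0 (∣∣-nonNeg _) λ eq → δ≉0 (∣∣≈0⇒≈0 eq)

      expanding : NonNeg (ι 1ℚ - ∣ δ (x 0) ∣) → ∀ j → Pos (∣ δ (x (suc j)) ∣ - ∣ δ (x 0) ∣)
      expanding s≤1 zero    = δ-expansion (double 0) x₀≤1 ∣δ∣>0 s≤1 (inj₁ (-‿inverseʳ _))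
      expanding s≤1 (suc j) = δ-expansion (double (suc j)) (x≤1 (suc j)) ∣δ∣>0 s≤1 (inj₂ (expanding s≤1 j))

      -- At j = k periodicity turns the strict growth into positivity of 0.
      ∣δ∣≰1 : ¬ NonNeg (ι 1ℚ - ∣ δ (x 0) ∣)
      ∣δ∣≰1 s≤1 = ¬pos-0 (trans (+-congʳ (∣∣-cong (δ-cong (sym x₀≈)))) (-‿inverseʳ _)) (expanding s≤1 k)

      ∣δ∣>1 : Pos (∣ δ (x 0) ∣ - ι 1ℚ)
      ∣δ∣>1 = Sum.[ (λ ≈1 → contradiction
            (inj₁ (trans (+-congˡ (-‿cong (x-y≈0⇒x≈y ≈1))) (-‿inverseʳ (ι 1ℚ)))) ∣δ∣≰1)
        , Sum.[ id , (λ <1 → contradiction (inj₂ (pos-resp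
            (solve 2 (λ d u → :- (d :- u) := u :- d) refl ∣ δ (x 0) ∣ (ι 1ℚ)) <1)) ∣δ∣≰1) ]′ ]′
        (sign (∣ δ (x 0) ∣ - ι 1ℚ))

    ∣δ∣>1⇒1<∣σ∞-σ∞∣ : ∀ x → Pos (∣ δ x ∣ - ι 1ℚ) → fromℚ 1ℚ <ℝ ∣ σ∞ x -ℝ σ∞ (conj x) ∣ℝ
    ∣δ∣>1⇒1<∣σ∞-σ∞∣ x δ>1 = Sum.[
        (λ eq → <ℝ⇒<ℝ∣∣ {1ℚ} {d} (pos-sub⇒<ℝ {ι 1ℚ} {δ x} {fromℚ 1ℚ} {d} (σ∞-ι 1ℚ) σ∞δ≈d (pos-resp (+-congʳ eq) δ>1)))
      , (λ eq → <ℝ-⇒<ℝ∣∣ {1ℚ} {d} (pos-sub⇒<ℝ {ι 1ℚ} { - δ x} {fromℚ 1ℚ} { -ℝ d} (σ∞-ι 1ℚ) (σ∞-neg {δ x} {d} σ∞δ≈d)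
          (pos-resp (+-congʳ eq) δ>1))) ] (∣∣-± (δ x))
      where
      d = σ∞ x -ℝ σ∞ (conj x)
      σ∞δ≈d : σ∞ (δ x) ≈ℝ d
      σ∞δ≈d = σ∞-sub {x} {conj x} {σ∞ x} {σ∞ (conj x)} (≈ℝ-refl (σ∞ x)) (≈ℝ-refl (σ∞ (conj x)))

    PropertyI⇒∣∣≤1 : ∀ {x} → PropertyI x → NonNeg (ι 1ℚ - ∣ x ∣)
    PropertyI⇒∣∣≤1 {x} ((-1<x , x≤1) , _) = ∣∣-bound
      (λ x>1 → x≤1 (pos-sub⇒<ℝ {ι 1ℚ} {x} {fromℚ 1ℚ} {σ∞ x} (σ∞-ι 1ℚ) (≈ℝ-refl (σ∞ x)) x>1))
      (λ x<-1 → pos-asym x<-1 (pos-resp (trans (+-congˡ (-‿cong (ι.-‿homo 1ℚ)))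
          (solve 2 (λ x u → x :- (:- u) := :- (:- x :- u)) refl x (ι 1ℚ)))
        (<ℝ⇒pos-sub {ι (ℚ.- 1ℚ)} {x} {fromℚ (ℚ.- 1ℚ)} {σ∞ x} (σ∞-ι (ℚ.- 1ℚ)) (≈ℝ-refl (σ∞ x)) -1<x)))

-- Both halves of the theorem, from the odd-indexed terms.

theorem3p12 : ∀ {c ℓ} (K : QuadraticField c ℓ) →
    let open QuadraticField K in
    (σ∞ : Carrier → ℝ) → IsRingMonomorphism rawRing ℝ-rawRing σ∞ →
    (σ₂ : Carrier → ℚ₂) → IsRingMonomorphism rawRing ℚ₂-rawRing σ₂ →
    (conj : Carrier → Carrier) → IsGaloisConjugation conj →
    let open Algorithm K σ∞ σ₂ in
    (α : Carrier) → Irrational α → PropertyI α →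
    (α[_] : ℕ → Carrier) → Generates α α[_] →
    (n₁ : ℕ) → 1 < n₁ → ¬ (2 ∣ n₁) → α[ 1 ] ≈ α[ n₁ ] →
    (σ₂ α , σ₂ (conj α)) ∈ D₂¹ × (σ∞ α , σ∞ (conj α)) ∈ D∞¹
theorem3p12 K σ∞ σ∞-mono σ₂ σ₂-mono conj isConj α irrational propI α[_] gen n₁ 1<n₁ odd-n₁ periodic
  with odd⇒1+2k odd-n₁
... | zero  , ≡.refl = contradiction 1<n₁ (ℕ.<-irrefl ≡.refl)
-- Here n₁ = 2(k + 1) + 1, so the period consists of k + 1 double steps.
... | suc k , ≡.refl =
      (proj₂ propI , ¬Val≥1⇒v₂≤0 {σ₂ (conj α)}
        (λ V1ᾱ → P.¬V1-conj (V-resp (conj.⟦⟧-cong (sym start)) (mk V1ᾱ))))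
    , (∣∣≤ℝ {σ∞ α} {1ℚ} (proj₁ (proj₁ propI)) (proj₂ (proj₁ propI))
      , ∣δ∣>1⇒1<∣σ∞-σ∞∣ α (pos-resp (+-congʳ (∣∣-cong (δ-cong start))) P.∣δ∣>1))
  where
  open QuadraticField K
  open QuadraticFieldProperties K
  open RealEmbedding σ∞ σ∞-mono
  open DyadicEmbedding σ₂ σ₂-mono
  open Conjugation conj isConj
  open Algorithm K σ∞ σ₂
  open Dynamics σ∞ σ∞-mono σ₂ σ₂-mono conj isConj
  open Generates gen
  -- The first step starts at the odd index 2j + 1 and the second at the even index 2j + 2.
  double : ∀ j → DoubleStep α[ suc (j ℕ.* 2) ] α[ suc (suc j ℕ.* 2) ]
  double j = T₂⇒DoubleStep (odd (suc (j ℕ.* 2)) (s≤s z≤n) (¬2∣1+2k j))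
                           (even (suc j ℕ.* 2) (s≤s z≤n) (ℕ.divides (suc j) ≡.refl))
  V1-α₁ : V 1 α[ 1 ]
  V1-α₁ = V-resp (sym start) (mk (v₂>0⇒Val≥1 {σ₂ α} (proj₂ propI)))
  ∣α₁∣≤1 : NonNeg (ι 1ℚ - ∣ α[ 1 ] ∣)
  ∣α₁∣≤1 = nonNeg-resp (+-congˡ (-‿cong (∣∣-cong (sym start)))) (PropertyI⇒∣∣≤1 propI)
  δα₁≉0 : δ α[ 1 ] ≉ 0#
  δα₁≉0 δ≈0 = irrational⇒conj≉ irrational (sym (x-y≈0⇒x≈y (trans (δ-cong (sym start)) δ≈0)))
  module P = Periodic (λ j → α[ suc (j ℕ.* 2) ]) double V1-α₁ ∣α₁∣≤1 δα₁≉0 k periodic
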